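{- Let $\mathbb{F}$ be a field, let $q\ge 2$ and $r$ be positive integers, and suppose that the rank over $\mathbb{F}$ of the matrix multiplication tensor $\langle q,q,q\rangle$ satisfies $R(\langle q,q,q\rangle)\le r$. Assume that field operations take $O(1)$ work. Then there exists a parallel matrix multiplication algorithm that computes the product $A\times B$ of any $A,B\in\mathbb{F}^{n\times n}$ using $O\left(n^{\log_q r}\right)$ work and $O\left((\log r+\log q)\log_q n\right)$ depth, using $O\left(n^{\log_q r}\right)$ space.
   Context: For positive integers $a,b,c$, the matrix multiplication tensor $\langle a,b,c\rangle$ is the tensor over the sets of variables $\{x_{ij}\}_{i\in[a],j\in[b]}$, $\{y_{jk}\}_{j\in[b],k\in[c]}$, $\{z_{ki}\}_{k\in[c],i\in[a]}$ given by $$\langle a,b,c\rangle=\sum_{i=1}^a\sum_{j=1}^b\sum_{k=1}^c x_{ij}y_{jk}z_{ki}.$$ The condition $R(\langle q,q,q\rangle)\le r$ means that there are coefficients $a_{ij\ell},b_{jk\ell},c_{ki\ell}\in\mathbb{F}$ with $$\langle q,q,q\rangle=\sum_{\ell=1}^r\Big(\sum_{i,j\in[q]}a_{ij\ell}x_{ij}\Big)\Big(\sum_{j,k\in[q]}b_{jk\ell}y_{jk}\Big)\Big(\sum_{k,i\in[q]}c_{ki\ell}z_{ki}\Big).$$ Computation is in the work-depth model: work is the total number of (field) operations, depth is the longest chain of sequential dependencies. The parameters $q,r$ are fixed, $n$ grows, and the constants hidden in the work and space bounds may depend on $q$ and $r$. -}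

module Defs where

open import Algebra.Apartness.Bundles using (HeytingField; HeytingCommutativeRing)
open import Algebra.Bundles using (CommutativeRing)
open import Data.Bool.Base using (if_then_else_)
open import Data.Fin.Base using (Fin)
import Data.Fin.Properties as Fin
open import Data.List.Base using (List; []; _∷_; length)
open import Data.List.Membership.Propositional using (_∈_)
open import Data.List.Relation.Binary.Sublist.Propositional using (_⊆_)
open import Data.List.Relation.Unary.Linked using (Linked)
open import Data.Nat.Base as ℕ using (ℕ; NonZero)
open import Data.Product.Base using (_×_; _,_; Σ-syntax)
open import Data.Product.Properties using (≡-dec)
open import Data.Sum.Base using (_⊎_; inj₁; inj₂)
open import Data.Vec.Functional using (Vector)
open import Function.Bundles using (_↣_; module Injection)
open import Level using (Level; Lift; _⊔_)
open import Relation.Binary.PropositionalEquality.Core using (_≢_)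
open import Relation.Nullary.Decidable.Core using (does)

------------------------------------------------------------------------
-- Comparisons with real quantities.  A non-negative real y is given by
-- the fractions p / t (t > 0) with y ≤ p / t; a natural number is ≤ an
-- expression monotone and continuous in such reals iff it is ≤ the
-- expression evaluated at all of these upper bounds.

-- log_b x ≤ p / t, for b ≥ 2 and x ≥ 1.
LogAtMost : (b x p t : ℕ) → Set
LogAtMost b x p t = x ℕ.^ t ℕ.≤ b ℕ.^ p

-- w ≤ C · n ^ (log_q r), i.e. w ≤ C · n ^ (p / t) whenever
-- log_q r ≤ p / t; both sides are raised to the power t.
WithinPower : (C n q r w : ℕ) → Set
WithinPower C n q r w =
  ∀ p t → .{{_ : NonZero t}} → LogAtMost q r p t →
  w ℕ.^ t ℕ.≤ C ℕ.^ t ℕ.* n ℕ.^ p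

-- d ≤ D · (log₂ r + log₂ q) · log_q n, i.e.
-- d ≤ D · (a / t + b / t) · (u / t) for all upper bounds a / t, b / t
-- and u / t of the three logarithms (a common denominator t loses no
-- generality).
WithinLogs : (D q r n d : ℕ) → Set
WithinLogs D q r n d =
  ∀ a b u t → .{{_ : NonZero t}} →
  LogAtMost 2 r a t → LogAtMost 2 q b t → LogAtMost q n u t →
  d ℕ.* (t ℕ.* t) ℕ.≤ D ℕ.* ((a ℕ.+ b) ℕ.* u)

Index : ℕ → ℕ → Set
Index m n = Fin m × Fin n

-- Classically, HeytingField is the usual notion of field, with x # y
-- meaning x ≉ y.
module _ {c ℓ₁ ℓ₂ : Level} (F : HeytingField c ℓ₁ ℓ₂) where

  open HeytingField F
  open import Algebra.Properties.Semiring.Sum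
    (CommutativeRing.semiring
      (HeytingCommutativeRing.commutativeRing heytingCommutativeRing))
    using (sum-syntax)

  ----------------------------------------------------------------------
  -- Tensors over three sets of variables, as coefficient arrays:
  -- T x y z is the coefficient of the monomial x y z.

  LinearForm : Set → Set c
  LinearForm X = X → Carrier

  Tensor : Set → Set → Set → Set c
  Tensor X Y Z = X → Y → Z → Carrier

  _⊠_⊠_ : ∀ {X Y Z} → LinearForm X → LinearForm Y → LinearForm Z → Tensor X Y Z
  (f ⊠ g ⊠ h) x y z = f x * g y * h z

  var : ∀ {m n} → Index m n → LinearForm (Index m n)
  var v w = if does (≡-dec Fin._≟_ Fin._≟_ v w) then 1# else 0#

  matMulTensor : ∀ a b c → Tensor (Index a b) (Index b c) (Index c a)
  matMulTensor a b c x y z =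
    ∑[ i < a ] ∑[ j < b ] ∑[ k < c ]
      (var (i , j) ⊠ var (j , k) ⊠ var (k , i)) x y z

  RankAtMost : ∀ {X Y Z} → Tensor X Y Z → ℕ → Set (c ⊔ ℓ₁)
  RankAtMost {X} {Y} {Z} T r =
    Σ[ α ∈ (Fin r → LinearForm X) ]
    Σ[ β ∈ (Fin r → LinearForm Y) ]
    Σ[ γ ∈ (Fin r → LinearForm Z) ]
      (∀ x y z → T x y z ≈ ∑[ ℓ < r ] (α ℓ ⊠ β ℓ ⊠ γ ℓ) x y z)

  ----------------------------------------------------------------------
  -- The work-depth model: straight-line programs over s memory cells,
  -- which may be read concurrently and overwritten.

  data Op : Set where
    add sub mul div : Op

  data Instr (s : ℕ) : Set c where
    load    : (target : Fin s) → Carrier → Instr s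
    compute : (target : Fin s) → Op → (left right : Fin s) → Instr s

  Program : ℕ → Set c
  Program s = List (Instr s)

  Memory : ℕ → Set c
  Memory s = Vector Carrier s

  -- Result o x y v: applying o to x and y succeeds with value v.
  Result : Op → Carrier → Carrier → Carrier → Set (ℓ₁ ⊔ ℓ₂)
  Result add x y v = Lift ℓ₂ (v ≈ x + y)
  Result sub x y v = Lift ℓ₂ (v ≈ x - y)
  Result mul x y v = Lift ℓ₂ (v ≈ x * y)
  Result div x y v = y # 0# × v * y ≈ x

  target : ∀ {s} → Instr s → Fin s
  target (load t _)        = t
  target (compute t _ _ _) = t

  sources : ∀ {s} → Instr s → List (Fin s)
  sources (load _ _)        = []
  sources (compute _ _ l r) = l ∷ r ∷ []

  Value : ∀ {s} → Instr s → Memory s → Carrier → Set (ℓ₁ ⊔ ℓ₂)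
  Value (load _ k)        M v = Lift ℓ₂ (v ≈ k)
  Value (compute _ o l r) M v = Result o (M l) (M r) v

  Step : ∀ {s} → Instr s → Memory s → Memory s → Set (ℓ₁ ⊔ ℓ₂)
  Step ι M M′ = Value ι M (M′ (target ι)) × (∀ i → i ≢ target ι → M′ i ≈ M i)

  data Run {s : ℕ} : Program s → Memory s → Memory s → Set (c ⊔ ℓ₁ ⊔ ℓ₂) where
    done : ∀ {M} → Run [] M M
    step : ∀ {ι π M M′ M″} → Step ι M M′ → Run π M′ M″ → Run (ι ∷ π) M M″

  work : ∀ {s} → Program s → ℕ
  work = length

  -- A later instruction κ has to wait for an earlier ι if κ reads or
  -- overwrites the cell written by ι, or overwrites a cell read by ι.
  Depends : ∀ {s} → Instr s → Instr s → Set
  Depends ι κ = target ι ∈ target κ ∷ sources κ ⊎ target κ ∈ sources ι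

  -- γ is a subsequence of π in which each instruction depends on the
  -- preceding one; the depth of π is the maximal length of such a γ.
  Chain : ∀ {s} → Program s → List (Instr s) → Set c
  Chain π γ = γ ⊆ π × Linked Depends γ

  ----------------------------------------------------------------------
  -- Matrix multiplication programs

  Matrix : ℕ → Set c
  Matrix n = Fin n → Fin n → Carrier

  matMul : ∀ {n} → Matrix n → Matrix n → Matrix n
  matMul {n} A B i k = ∑[ j < n ] (A i j * B j k)

  record MatrixProgram (n : ℕ) : Set c where
    field
      space   : ℕ        -- all cells: input, output and scratch
      program : Program space
      input   : (Index n n ⊎ Index n n) ↣ Fin space
      output  : Index n n → Fin space

    leftCell rightCell : Fin n → Fin n → Fin space
    leftCell  i j = Injection.to input (inj₁ (i , j))
    rightCell i j = Injection.to input (inj₂ (i , j))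

  -- Cells other than the input cells hold arbitrary values initially.
  Multiplies : ∀ {n} → MatrixProgram n → Set (c ⊔ ℓ₁ ⊔ ℓ₂)
  Multiplies {n} P =
    ∀ (A B : Matrix n) (M : Memory space) →
    (∀ i j → M (leftCell i j) ≈ A i j) →
    (∀ i j → M (rightCell i j) ≈ B i j) →
    Σ[ M′ ∈ Memory space ] (Run program M M′ ×
      (∀ i k → M′ (output (i , k)) ≈ matMul A B i k))
    where open MatrixProgram P

{-# OPTIONS --safe #-}
-- The algorithm is Strassen's recursion for the given decomposition, run on
-- a whole batch of products at once: each recursive step computes the linear
-- forms of all blocks of all products, which turns m products of order
-- q ^ (k + 1) into m r products of order q ^ k.  Each step therefore consists
-- of O(log q + log r) layers of independent gates, and its sums are balanced
-- binary trees.
--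
-- The work per step, proportional to q ^ (2 k) for each product, adds up to
-- O(r ^ k) because r > q².  This is forced by the rank hypothesis: if r ≤ q²,
-- some nonzero A is annihilated by all α ℓ but one, so that B ↦ A B has rank
-- at most one, which is absurd for q ≥ 2.
--
-- For n < q the recursion for ⟨q,q,q⟩ would be deeper than O(log n), and the
-- trivial decomposition of ⟨2,2,2⟩ is used instead; its work is bounded in
-- terms of q.
module Submission where

import Algebra.Apartness.Properties.HeytingCommutativeRing as HeytingProperties
import Algebra.Properties.Ring as RingProperties
import Algebra.Properties.Semiring.Sum as SumProperties
import Algebra.Solver.Ring.NaturalCoefficients.Default as SemiringSolver
import Data.Fin.Properties as Fin
import Data.List.Properties as List
import Data.List.Relation.Binary.Sublist.Propositional as Sublist
import Data.List.Relation.Unary.All.Properties as All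
import Data.List.Relation.Unary.AllPairs.Properties as AllPairs
import Data.Nat.Properties as ℕ
import Data.Vec.Functional.Properties as Vector
import Relation.Binary.Reasoning.Setoid as SetoidReasoning
open import Algebra.Apartness.Bundles using (HeytingField; HeytingCommutativeRing)
open import Algebra.Bundles using (CommutativeRing)
open import Data.Bool.Base using (if_then_else_)
open import Data.Fin.Base
  using (Fin; zero; suc; _↑ˡ_; _↑ʳ_; splitAt; combine; remQuot; punchIn; punchOut; inject≤)
open import Data.Fin.Patterns using (0F; 1F)
open import Data.List.Base as List using (List; []; _∷_; length)
open import Data.List.Membership.Propositional using (_∈_)
open import Data.List.Membership.Propositional.Properties using (∈-allFin; ∈-map⁻)
open import Data.List.Relation.Binary.Sublist.Propositional using (_⊆_)
open import Data.List.Relation.Unary.All as All using (All; []; _∷_)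
open import Data.List.Relation.Unary.AllPairs as AllPairs using (AllPairs; []; _∷_)
open import Data.List.Relation.Unary.Any using (here; there)
open import Data.List.Relation.Unary.Linked using (Linked; [-]; _∷_)
open import Data.Nat.Base as ℕ using (ℕ; zero; suc; _≤_; _<_; z≤n; s≤s)
open import Data.Nat.Solver using (module +-*-Solver)
open import Data.Product.Base using (_×_; _,_; ∃-syntax; Σ-syntax; proj₁; proj₂)
open import Data.Product.Function.NonDependent.Propositional using (_×-↔_)
open import Data.Product.Properties using (≡-dec)
open import Data.Sum.Base using (_⊎_; inj₁; inj₂; [_,_]′)
open import Data.Sum.Function.Propositional using (_⊎-↔_)
open import Data.Vec.Functional using (Vector; updateAt) renaming (_∷_ to _◂_; _++_ to _⧺_)
open import Function.Base using (_∘_; _$_; id; const)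
open import Function.Bundles using (_↔_; mk↣; module Inverse; module Injection)
open import Function.Construct.Composition using (_↔-∘_)
open import Function.Construct.Identity using (↔-id)
open import Function.Construct.Symmetry using (↔-sym)
open import Function.Properties.Inverse using (↔⇒↣)
open import Level using (Level; _⊔_; lift)
open import Relation.Binary.PropositionalEquality as ≡ using (_≡_; _≢_)
open import Relation.Nullary.Decidable using (yes; no; dec-true; dec-false)
open import Relation.Nullary.Negation.Core using (¬_; contradiction)
open import Defs

-- The depth constant is fixed before q and r, and the work and space constant before the field. The
-- shape of the circuit must therefore not depend on the coefficients of the decomposition: every
-- linear form is evaluated with all its coefficients, zeros included, as a sum padded to a power of
-- two fixed by ⌈log₂ q⌉ and ⌈log₂ r⌉. All logarithms are rounded up to integers. In the depth bound
-- this is harmless for a logarithm that is at least 1, as log₂ q and log₂ r are, and log_q n for n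
-- ≥ q. For smaller n the value log_q n can be arbitrarily close to 0 while its rounding is 1, so
-- that no absolute factor could absorb the difference.

-- Integer logarithms and bounds with real exponents

module Logarithms where

  open import Data.Nat.Base
  open import Data.Nat.Properties

  ^-distribʳ-* : ∀ m n o → (m * n) ^ o ≡ m ^ o * n ^ o
  ^-distribʳ-* m n zero    = ≡.refl
  ^-distribʳ-* m n (suc o) = ≡.trans
    (≡.cong (m * n *_) (^-distribʳ-* m n o))
    (solve 4 (λ a b c d → (a :* b) :* (c :* d) := (a :* c) :* (b :* d))
      ≡.refl m n (m ^ o) (n ^ o))
    where open +-*-Solver

  ^-comm-exponents : ∀ m n o → (m ^ n) ^ o ≡ (m ^ o) ^ n
  ^-comm-exponents m n o = ≡.trans (^-*-assoc m n o)
    (≡.trans (≡.cong (m ^_) (*-comm n o)) (≡.sym (^-*-assoc m o n)))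

  ^-cancelˡ-≤ : ∀ {b m n} → 2 ≤ b → b ^ m ≤ b ^ n → m ≤ n
  ^-cancelˡ-≤ {b} {m} {n} 2≤b bᵐ≤bⁿ with m ≤? n
  ... | yes m≤n = m≤n
  ... | no  m≰n = contradiction bᵐ≤bⁿ (<⇒≱ (^-monoʳ-< b 2≤b (≰⇒> m≰n)))

  -- Minimality is stated for all smaller `j` instead of the predecessor of `exponent`, which avoids
  -- truncated subtraction and is vacuous for exponent 0.
  record CeilLog (b n : ℕ) : Set where
    field
      exponent : ℕ
      upper    : n ≤ b ^ exponent
      lower    : ∀ {j} → j < exponent → b ^ j < n

  -- Passing from n to n + 1 raises the exponent by at most one, since n ≤ b ^ k < b ^ (k + 1).
  ceilLog : ∀ {b} → 2 ≤ b → ∀ n → CeilLog b n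
  ceilLog 2≤b zero = record { exponent = 0 ; upper = z≤n ; lower = λ () }
  ceilLog {b} 2≤b (suc n) with ceilLog 2≤b n
  ... | record { exponent = k ; upper = n≤bᵏ ; lower = lower } with suc n ≤? b ^ k
  ...   | yes n<bᵏ = record { exponent = k ; upper = n<bᵏ ; lower = λ j<k → m<n⇒m<1+n (lower j<k) }
  ...   | no  n≮bᵏ = record
    { exponent = suc k
    ; upper    = ≤-<-trans n≤bᵏ (^-monoʳ-< b 2≤b (n<1+n k))
    ; lower    = λ j≤k → ≤-<-trans (^-monoʳ-≤ b {{>-nonZero (<⇒≤ 2≤b)}} (s≤s⁻¹ j≤k)) (≰⇒> n≮bᵏ)
    }

  open CeilLog

  exponent-positive : ∀ {b n} → 2 ≤ n → (c : CeilLog b n) → 1 ≤ exponent c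
  exponent-positive 2≤n c with exponent c | upper c
  ... | zero  | n≤1 = contradiction (≤-trans 2≤n n≤1) (<⇒≱ ≤-refl)
  ... | suc _ | _   = s≤s z≤n

  exponent≤ : ∀ {b n} → 2 ≤ b → (c : CeilLog b n) → exponent c ≤ n
  exponent≤ {b} 2≤b c with exponent c | lower c
  ... | zero  | _     = z≤n
  ... | suc k | lower = ≤-<-trans (k≤bᵏ k) (lower ≤-refl)
    where
    k≤bᵏ : ∀ k → k ≤ b ^ k
    k≤bᵏ zero    = z≤n
    k≤bᵏ (suc k) = ≤-<-trans (k≤bᵏ k) (^-monoʳ-< b 2≤b (n<1+n k))

  -- Rounding log_b n up at most doubles it, because log_b n ≥ 1.
  exponent-logAtMost : ∀ {b n p t} → 2 ≤ b → b ≤ n → (c : CeilLog b n) →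
                       LogAtMost b n p t → exponent c * t ≤ 2 * p
  exponent-logAtMost {b} {n} {p} {t} 2≤b b≤n c nᵗ≤bᵖ with exponent c | lower c
  ... | zero  | _     = z≤n
  ... | suc k | lower = begin
    t + k * t ≤⟨ +-mono-≤ t≤p kt≤p ⟩
    p + p     ≡⟨ ≡.cong (p +_) (+-identityʳ p) ⟨
    2 * p     ∎
    where
    open ≤-Reasoning
    t≤p : t ≤ p
    t≤p = ^-cancelˡ-≤ 2≤b (≤-trans (^-monoˡ-≤ t b≤n) nᵗ≤bᵖ)
    kt≤p : k * t ≤ p
    kt≤p = ^-cancelˡ-≤ 2≤b (begin
      b ^ (k * t) ≡⟨ ^-*-assoc b k t ⟨
      (b ^ k) ^ t ≤⟨ ^-monoˡ-≤ t (<⇒≤ (lower ≤-refl)) ⟩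
      n ^ t       ≤⟨ nᵗ≤bᵖ ⟩
      b ^ p       ∎)

  -- The change of base log_b n = log_b q · log_q n, in terms of upper bounds.
  logAtMost-trans : ∀ {b q n p u t} → LogAtMost b q p t → LogAtMost q n u t →
                    LogAtMost b n (p * u) (t * t)
  logAtMost-trans {b} {q} {n} {p} {u} {t} qᵗ≤bᵖ nᵗ≤qᵘ = begin
    n ^ (t * t) ≡⟨ ^-*-assoc n t t ⟨
    (n ^ t) ^ t ≤⟨ ^-monoˡ-≤ t nᵗ≤qᵘ ⟩
    (q ^ u) ^ t ≡⟨ ^-comm-exponents q u t ⟩
    (q ^ t) ^ u ≤⟨ ^-monoˡ-≤ u qᵗ≤bᵖ ⟩
    (b ^ p) ^ u ≡⟨ ^-*-assoc b p u ⟩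
    b ^ (p * u) ∎
    where open ≤-Reasoning

  withinPower-const : ∀ {C n q r w} → 1 ≤ n → w ≤ C → WithinPower C n q r w
  withinPower-const {C} {n} {q} {r} {w} 1≤n w≤C p t _ = begin
    w ^ t         ≤⟨ ^-monoˡ-≤ t w≤C ⟩
    C ^ t         ≡⟨ *-identityʳ (C ^ t) ⟨
    C ^ t * 1     ≤⟨ *-monoʳ-≤ (C ^ t) (m^n>0 n {{>-nonZero 1≤n}} p) ⟩
    C ^ t * n ^ p ∎
    where open ≤-Reasoning

  -- With k + 1 the rounded exponent, q ^ k < n gives r ^ k ≤ n ^ (log_q r). Rounding n up to a
  -- power of q thus costs a single factor r, which joins the constant.
  withinPower-exponent : ∀ {C n q r w} → 1 ≤ n → (c : CeilLog q n) → 1 ≤ exponent c →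
                         w ≤ C * r ^ exponent c → WithinPower (C * r) n q r w
  withinPower-exponent {C} {n} {q} {r} {w} 1≤n c 1≤k w≤Crᵏ p t rᵗ≤qᵖ
    with exponent c | lower c
  ... | suc k | lower = begin
    w ^ t                           ≤⟨ ^-monoˡ-≤ t w≤Crᵏ ⟩
    (C * (r * r ^ k)) ^ t           ≡⟨ ≡.cong (_^ t) (*-assoc C r (r ^ k)) ⟨
    (C * r * r ^ k) ^ t             ≡⟨ ^-distribʳ-* (C * r) (r ^ k) t ⟩
    (C * r) ^ t * (r ^ k) ^ t       ≡⟨ ≡.cong ((C * r) ^ t *_) (^-comm-exponents r k t) ⟩
    (C * r) ^ t * (r ^ t) ^ k       ≤⟨ *-monoʳ-≤ ((C * r) ^ t) (^-monoˡ-≤ k rᵗ≤qᵖ) ⟩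
    (C * r) ^ t * (q ^ p) ^ k       ≡⟨ ≡.cong ((C * r) ^ t *_) (^-comm-exponents q p k) ⟩
    (C * r) ^ t * (q ^ k) ^ p       ≤⟨ *-monoʳ-≤ ((C * r) ^ t) (^-monoˡ-≤ p (<⇒≤ (lower ≤-refl))) ⟩
    (C * r) ^ t * n ^ p             ∎
    where open ≤-Reasoning

  withinPower-mono : ∀ {C C′ n q r w} → C ≤ C′ → WithinPower C n q r w → WithinPower C′ n q r w
  withinPower-mono {n = n} C≤C′ within p t h =
    ≤-trans (within p t h) (*-monoˡ-≤ (n ^ p) (^-monoˡ-≤ t C≤C′))

open Logarithms
open CeilLog

-- Finite sums, and bilinear algorithms from tensor decompositions

pad : ∀ {ℓ} {A : Set ℓ} {m} n → A → Vector A m → Vector A n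
pad {m = zero}  _       x _  _       = x
pad {m = suc _} (suc _) _ xs zero    = xs zero
pad {m = suc _} (suc n) x xs (suc i) = pad n x (xs ∘ suc) i

module Sums {c ℓ₁ ℓ₂ : Level} (F : HeytingField c ℓ₁ ℓ₂) where

  open HeytingField F hiding (zero)
  open CommutativeRing (HeytingCommutativeRing.commutativeRing heytingCommutativeRing) public
    using (semiring; commutativeSemiring; ring)
  open SumProperties semiring public
  open SetoidReasoning setoid
  private module ≈-Solver = SemiringSolver commutativeSemiring

  sum-cong : ∀ n {f g : Vector Carrier n} → (∀ i → f i ≈ g i) → sum f ≈ sum g
  sum-cong n {f} {g} = sum-cong-≋ {n} {f} {g}

  sum-zero : ∀ n {f : Vector Carrier n} → (∀ i → f i ≈ 0#) → sum f ≈ 0#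
  sum-zero n f≈0 = trans (sum-cong n f≈0) (sum-replicate-zero n)

  sum-single : ∀ {n} {f : Vector Carrier n} i → (∀ j → j ≢ i → f j ≈ 0#) → sum f ≈ f i
  sum-single {suc n} {f} i f≈0 = begin
    sum f                      ≈⟨ sum-remove {i = i} f ⟩
    f i + sum (f ∘ punchIn i)  ≈⟨ +-congˡ (sum-zero n λ j → f≈0 _ (Fin.punchInᵢ≢i i j)) ⟩
    f i + 0#                   ≈⟨ +-identityʳ _ ⟩
    f i                        ∎

  sum-++ : ∀ m {n} (f : Vector Carrier (m ℕ.+ n)) →
           sum f ≈ ∑[ i < m ] f (i ↑ˡ n) + ∑[ j < n ] f (m ↑ʳ j)
  sum-++ zero    f = sym (+-identityˡ _)
  sum-++ (suc m) f = trans (+-congˡ (sum-++ m (f ∘ suc))) (sym (+-assoc _ _ _))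

  sum-combine : ∀ m n (f : Vector Carrier (m ℕ.* n)) →
                sum f ≈ ∑[ i < m ] ∑[ j < n ] f (combine i j)
  sum-combine zero    n f = refl
  sum-combine (suc m) n f = trans (sum-++ n f) (+-congˡ (sum-combine m n (f ∘ (n ↑ʳ_))))

  ∑∑-cong : ∀ m n {f g : Fin m → Fin n → Carrier} → (∀ i j → f i j ≈ g i j) →
            ∑[ i < m ] ∑[ j < n ] f i j ≈ ∑[ i < m ] ∑[ j < n ] g i j
  ∑∑-cong m n f≈g = sum-cong m λ i → sum-cong n (f≈g i)

  sum-remQuot : ∀ m n (f : Fin m × Fin n → Carrier) →
                ∑[ i < m ℕ.* n ] f (remQuot n i) ≈ ∑[ i < m ] ∑[ j < n ] f (i , j)
  sum-remQuot m n f = trans (sum-combine m n (f ∘ remQuot {m} n))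
    (∑∑-cong m n λ i j → reflexive (≡.cong f (Fin.remQuot-combine i j)))

  sum-pad : ∀ {m n x} → m ≤ n → x ≈ 0# → (f : Vector Carrier m) → sum (pad n x f) ≈ sum f
  sum-pad {zero}  {n} m≤n       x≈0 f = sum-zero n (λ _ → x≈0)
  sum-pad {suc m}     (s≤s m≤n) x≈0 f = +-congˡ (sum-pad m≤n x≈0 (f ∘ suc))

  *-distribˡ-∑∑ : ∀ m n x (f : Fin m → Fin n → Carrier) →
                  x * ∑[ i < m ] ∑[ j < n ] f i j ≈ ∑[ i < m ] ∑[ j < n ] (x * f i j)
  *-distribˡ-∑∑ m n x f = trans (*-distribˡ-sum {m} x _) (sum-cong m λ i → *-distribˡ-sum x (f i))

  *-distribʳ-∑∑ : ∀ m n x (f : Fin m → Fin n → Carrier) →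
                  (∑[ i < m ] ∑[ j < n ] f i j) * x ≈ ∑[ i < m ] ∑[ j < n ] (f i j * x)
  *-distribʳ-∑∑ m n x f = trans (*-distribʳ-sum {m} x _) (sum-cong m λ i → *-distribʳ-sum x (f i))

  ∑∑-comm-∑ : ∀ {m n p} (f : Fin m → Fin n → Fin p → Carrier) →
              ∑[ i < m ] ∑[ j < n ] ∑[ ℓ < p ] f i j ℓ ≈ ∑[ ℓ < p ] ∑[ i < m ] ∑[ j < n ] f i j ℓ
  ∑∑-comm-∑ {m} {n} {p} f = trans (sum-cong m λ i → ∑-comm (f i))
    (∑-comm (λ i ℓ → ∑[ j < n ] f i j ℓ))

  -- Contracting a tensor with two vectors

  apply : ∀ {m n} → LinearForm F (Index m n) → (Index m n → Carrier) → Carrier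
  apply {m} {n} f a = ∑[ i < m ] ∑[ j < n ] (f (i , j) * a (i , j))

  contract : ∀ {m n p q} {Z : Set} → Tensor F (Index m n) (Index p q) Z →
             (Index m n → Carrier) → (Index p q → Carrier) → Z → Carrier
  contract {m} {n} {p} {q} T a b z =
    ∑[ i < m ] ∑[ j < n ] ∑[ i′ < p ] ∑[ j′ < q ] (T (i , j) (i′ , j′) z * (a (i , j) * b (i′ , j′)))

  contract-cong : ∀ {m n p q Z} {T U : Tensor F (Index m n) (Index p q) Z} →
                  (∀ x y z → T x y z ≈ U x y z) → ∀ a b z → contract T a b z ≈ contract U a b z
  contract-cong {m} {n} {p} {q} T≈U a b z =
    ∑∑-cong m n λ i j → ∑∑-cong p q λ i′ j′ → *-congʳ (T≈U (i , j) (i′ , j′) z)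

  contract-sum : ∀ {m n p q Z} r (T : Fin r → Tensor F (Index m n) (Index p q) Z) a b z →
                 contract (λ x y z → ∑[ ℓ < r ] T ℓ x y z) a b z ≈ ∑[ ℓ < r ] contract (T ℓ) a b z
  contract-sum {m} {n} {p} {q} r T a b z = begin
    contract (λ x y z → ∑[ ℓ < r ] T ℓ x y z) a b z
      ≈⟨ (∑∑-cong m n λ i j → ∑∑-cong p q λ i′ j′ → *-distribʳ-sum {r} _ _) ⟩
    ∑[ i < m ] ∑[ j < n ] ∑[ i′ < p ] ∑[ j′ < q ] ∑[ ℓ < r ] t ℓ i j i′ j′
      ≈⟨ (∑∑-cong m n λ i j → ∑∑-comm-∑ (λ i′ j′ ℓ → t ℓ i j i′ j′)) ⟩
    ∑[ i < m ] ∑[ j < n ] ∑[ ℓ < r ] ∑[ i′ < p ] ∑[ j′ < q ] t ℓ i j i′ j′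
      ≈⟨ ∑∑-comm-∑ (λ i j ℓ → ∑[ i′ < p ] ∑[ j′ < q ] t ℓ i j i′ j′) ⟩
    ∑[ ℓ < r ] contract (T ℓ) a b z ∎
    where
    t : Fin r → Fin m → Fin n → Fin p → Fin q → Carrier
    t ℓ i j i′ j′ = T ℓ (i , j) (i′ , j′) z * (a (i , j) * b (i′ , j′))

  -- This is why a decomposition is an algorithm: a rank-one term needs only one multiplication of
  -- two non-constant quantities.
  contract-⊠ : ∀ {m n p q} {Z : Set} (f : LinearForm F (Index m n)) (g : LinearForm F (Index p q))
               (h : LinearForm F Z) a b z →
               contract (_⊠_⊠_ F f g h) a b z ≈ apply f a * apply g b * h z
  contract-⊠ {m} {n} {p} {q} f g h a b z = begin
    contract (_⊠_⊠_ F f g h) a b z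
      ≈⟨ (∑∑-cong m n λ i j → ∑∑-cong p q λ i′ j′ → rearranged _ _ _ _ _) ⟩
    ∑[ i < m ] ∑[ j < n ] ∑[ i′ < p ] ∑[ j′ < q ]
      (fa i j * gb i′ j′ * h z)
      ≈⟨ (∑∑-cong m n λ i j → *-distribʳ-∑∑ p q (h z) (λ i′ j′ → fa i j * gb i′ j′)) ⟨
    ∑[ i < m ] ∑[ j < n ] ((∑[ i′ < p ] ∑[ j′ < q ] (fa i j * gb i′ j′)) * h z)
      ≈⟨ (∑∑-cong m n λ i j → *-congʳ (*-distribˡ-∑∑ p q (fa i j) gb)) ⟨
    ∑[ i < m ] ∑[ j < n ] (fa i j * apply g b * h z)
      ≈⟨ *-distribʳ-∑∑ m n (h z) (λ i j → fa i j * apply g b) ⟨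
    (∑[ i < m ] ∑[ j < n ] (fa i j * apply g b)) * h z
      ≈⟨ *-congʳ (*-distribʳ-∑∑ m n (apply g b) fa) ⟨
    apply f a * apply g b * h z ∎
    where
    fa : Fin m → Fin n → Carrier
    fa i j = f (i , j) * a (i , j)
    gb : Fin p → Fin q → Carrier
    gb i j = g (i , j) * b (i , j)
    rearranged : ∀ u v w x y → u * v * w * (x * y) ≈ u * x * (v * y) * w
    rearranged = solve 5 (λ u v w x y → u :* v :* w :* (x :* y) := u :* x :* (v :* y) :* w) refl
      where open ≈-Solver

  var-≡ : ∀ {m n} (v : Index m n) → var F v v ≈ 1#
  var-≡ v = reflexive (≡.cong (λ t → if t then 1# else 0#) (dec-true (≡-dec Fin._≟_ Fin._≟_ v v) ≡.refl))

  var-≢ : ∀ {m n} {v w : Index m n} → v ≢ w → var F v w ≈ 0#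
  var-≢ {v = v} {w} v≢w =
    reflexive (≡.cong (λ t → if t then 1# else 0#) (dec-false (≡-dec Fin._≟_ Fin._≟_ v w) v≢w))

  ∑∑-single : ∀ {m n} {f : Index m n → Carrier} v → (∀ w → w ≢ v → f w ≈ 0#) →
              ∑[ i < m ] ∑[ j < n ] f (i , j) ≈ f v
  ∑∑-single {n = n} (i , j) f≈0 = trans
    (sum-single i λ i′ i′≢i → sum-zero n λ j′ → f≈0 _ (i′≢i ∘ ≡.cong proj₁))
    (sum-single j λ j′ j′≢j → f≈0 _ (j′≢j ∘ ≡.cong proj₂))

  apply-var : ∀ {m n} (v : Index m n) a → apply (var F v) a ≈ a v
  apply-var v a = begin
    apply (var F v) a ≈⟨ ∑∑-single v (λ w w≢v → trans (*-congʳ (var-≢ (w≢v ∘ ≡.sym))) (zeroˡ (a w))) ⟩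
    var F v v * a v   ≈⟨ *-congʳ (var-≡ v) ⟩
    1# * a v          ≈⟨ *-identityˡ _ ⟩
    a v               ∎

  -- The z variables carry the transposed index, so `(k , i)` selects row i and column k. Every
  -- other term of the outer sums is killed by `var`.
  contract-matMulTensor : ∀ l m n (a : Index l m → Carrier) (b : Index m n → Carrier) i k →
    contract (matMulTensor F l m n) a b (k , i) ≈ ∑[ j < m ] (a (i , j) * b (j , k))
  contract-matMulTensor l m n a b i k = begin
    contract (matMulTensor F l m n) a b (k , i)
      ≈⟨ contract-sum l (λ i x y z → ∑[ j < m ] ∑[ k < n ] t i j k x y z) a b (k , i) ⟩
    _ ≈⟨ (sum-cong l λ i′ → contract-sum m (λ j x y z → ∑[ k < n ] t i′ j k x y z) a b (k , i)) ⟩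
    _ ≈⟨ (∑∑-cong l m λ i′ j → contract-sum n (t i′ j) a b (k , i)) ⟩
    _ ≈⟨ (∑∑-cong l m λ i′ j → sum-cong n λ k′ →
           contract-⊠ (var F (i′ , j)) (var F (j , k′)) (var F (k′ , i′)) a b (k , i)) ⟩
    ∑[ i′ < l ] ∑[ j < m ] ∑[ k′ < n ]
      (apply (var F (i′ , j)) a * apply (var F (j , k′)) b * var F (k′ , i′) (k , i))
      ≈⟨ sum-single i (λ i′ i′≢i → sum-zero m λ j → sum-zero n λ k′ →
           trans (*-congˡ (var-≢ {v = k′ , i′} {k , i} (i′≢i ∘ ≡.cong proj₂))) (zeroʳ _)) ⟩
    ∑[ j < m ] ∑[ k′ < n ]
      (apply (var F (i , j)) a * apply (var F (j , k′)) b * var F (k′ , i) (k , i))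
      ≈⟨ (sum-cong m λ j → sum-single k λ k′ k′≢k →
           trans (*-congˡ (var-≢ {v = k′ , i} {k , i} (k′≢k ∘ ≡.cong proj₁))) (zeroʳ _)) ⟩
    ∑[ j < m ] (apply (var F (i , j)) a * apply (var F (j , k)) b * var F (k , i) (k , i))
      ≈⟨ (sum-cong m λ j → *-cong (*-cong (apply-var (i , j) a) (apply-var (j , k) b)) (var-≡ (k , i))) ⟩
    ∑[ j < m ] (a (i , j) * b (j , k) * 1#)
      ≈⟨ (sum-cong m λ j → *-identityʳ _) ⟩
    ∑[ j < m ] (a (i , j) * b (j , k)) ∎
    where
    t : Fin l → Fin m → Fin n → Tensor F (Index l m) (Index m n) (Index n l)
    t i j k = _⊠_⊠_ F (var F (i , j)) (var F (j , k)) (var F (k , i))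

  -- Correctness speaks of scalar matrices only. The version for matrices of blocks is derived from
  -- it in `blockwise`, entry by entry.
  record BilinearAlgorithm (q r : ℕ) : Set (c ⊔ ℓ₁) where
    field
      α β γ   : Fin r → LinearForm F (Index q q)
      correct : ∀ a b i k →
                ∑[ ℓ < r ] (γ ℓ (k , i) * (apply (α ℓ) a * apply (β ℓ) b)) ≈
                ∑[ j < q ] (a (i , j) * b (j , k))

  bilinearAlgorithm : ∀ {q r} → RankAtMost F (matMulTensor F q q q) r → BilinearAlgorithm q r
  bilinearAlgorithm {q} {r} (α , β , γ , T≈) = record
    { α = α ; β = β ; γ = γ
    ; correct = λ a b i k → begin
        ∑[ ℓ < r ] (γ ℓ (k , i) * (apply (α ℓ) a * apply (β ℓ) b))
          ≈⟨ (sum-cong r λ ℓ → *-comm (γ ℓ (k , i)) _) ⟩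
        ∑[ ℓ < r ] (apply (α ℓ) a * apply (β ℓ) b * γ ℓ (k , i))
          ≈⟨ (sum-cong r λ ℓ → contract-⊠ (α ℓ) (β ℓ) (γ ℓ) a b (k , i)) ⟨
        ∑[ ℓ < r ] contract (_⊠_⊠_ F (α ℓ) (β ℓ) (γ ℓ)) a b (k , i)
          ≈⟨ contract-sum r (λ ℓ → _⊠_⊠_ F (α ℓ) (β ℓ) (γ ℓ)) a b (k , i) ⟨
        contract (λ x y z → ∑[ ℓ < r ] (_⊠_⊠_ F (α ℓ) (β ℓ) (γ ℓ)) x y z) a b (k , i)
          ≈⟨ contract-cong T≈ a b (k , i) ⟨
        contract (matMulTensor F q q q) a b (k , i)
          ≈⟨ contract-matMulTensor q q q a b i k ⟩
        ∑[ j < q ] (a (i , j) * b (j , k)) ∎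
    }

  -- The defining triple sum is itself a decomposition; for q = 2 it has eight terms.
  rank-matMulTensor≤ : ∀ q → RankAtMost F (matMulTensor F q q q) (q ℕ.* (q ℕ.* q))
  rank-matMulTensor≤ q =
      (λ ℓ → let i , j , k = indices ℓ in var F (i , j))
    , (λ ℓ → let i , j , k = indices ℓ in var F (j , k))
    , (λ ℓ → let i , j , k = indices ℓ in var F (k , i))
    , λ x y z → sym (trans
        (sum-remQuot q (q ℕ.* q) (λ (i , jk) → let j , k = remQuot q jk in
          _⊠_⊠_ F (var F (i , j)) (var F (j , k)) (var F (k , i)) x y z))
        (sum-cong q λ i → sum-remQuot q q λ (j , k) →
          _⊠_⊠_ F (var F (i , j)) (var F (j , k)) (var F (k , i)) x y z))
    where
    indices : Fin (q ℕ.* (q ℕ.* q)) → Fin q × Fin q × Fin q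
    indices ℓ = let i , jk = remQuot (q ℕ.* q) ℓ in i , remQuot q jk

-- The rank of ⟨q,q,q⟩ exceeds q²

module Rank {c ℓ₁ ℓ₂ : Level} (F : HeytingField c ℓ₁ ℓ₂) where

  open HeytingField F hiding (zero)
  open Sums F
  open HeytingProperties heytingCommutativeRing using (1#0; x#0y#0→xy#0; #-congʳ)
  open RingProperties ring using (-‿distribʳ-*; -‿distribˡ-*)
  open SetoidReasoning setoid
  private module ≈-Solver = SemiringSolver commutativeSemiring

  *-zeroʳ : ∀ x {y} → y ≈ 0# → x * y ≈ 0#
  *-zeroʳ x y≈0 = trans (*-congˡ y≈0) (zeroʳ x)

  Kernel : ∀ {m n} → (Fin m → Fin n → Carrier) → Set (c ⊔ ℓ₁ ⊔ ℓ₂)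
  Kernel {m} {n} a = Σ[ x ∈ (Fin n → Carrier) ]
    (∃[ j ] x j # 0#) × (∀ i → ∑[ j < n ] (a i j * x j) ≈ 0#)

  -- One step of Gaussian elimination without division. The remaining rows are cross-multiplied with
  -- the pivot row, and a solution y of the reduced system is scaled by the pivot p; the first
  -- unknown is then minus the rest of the pivot row applied to y.
  kernel-extend : ∀ {m n} (a : Fin (suc m) → Fin (suc n) → Carrier) i₀ → a i₀ zero # 0# →
    Kernel (λ i j → a i₀ zero * a (punchIn i₀ i) (suc j) - a (punchIn i₀ i) zero * a i₀ (suc j)) →
    Kernel a
  kernel-extend {m} {n} a i₀ pivot#0 (y , (j₀ , yⱼ#0) , solves) =
      x
    , (suc j₀ , x#0y#0→xy#0 pivot#0 yⱼ#0)
    , λ i → trans (row i) (vanishes i)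
    where
    p : Carrier
    p = a i₀ zero
    T : Fin (suc m) → Carrier
    T i = ∑[ j < n ] (a i (suc j) * y j)
    x : Fin (suc n) → Carrier
    x = - T i₀ ◂ λ j → p * y j

    row : ∀ i → ∑[ j < suc n ] (a i j * x j) ≈ p * T i - a i zero * T i₀
    row i = begin
      a i zero * - T i₀ + ∑[ j < n ] (a i (suc j) * (p * y j))
        ≈⟨ +-comm _ _ ⟩
      ∑[ j < n ] (a i (suc j) * (p * y j)) + a i zero * - T i₀
        ≈⟨ +-cong (sum-cong n λ j → swap (a i (suc j)) p (y j)) (sym (-‿distribʳ-* (a i zero) (T i₀))) ⟩
      ∑[ j < n ] (p * (a i (suc j) * y j)) - a i zero * T i₀
        ≈⟨ +-congʳ (*-distribˡ-sum {n} p _) ⟨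
      p * T i - a i zero * T i₀ ∎
      where
      swap : ∀ u v w → u * (v * w) ≈ v * (u * w)
      swap = solve 3 (λ u v w → u :* (v :* w) := v :* (u :* w)) refl
        where open ≈-Solver

    punched : ∀ i → let i′ = punchIn i₀ i in p * T i′ - a i′ zero * T i₀ ≈ 0#
    punched i = begin
      p * T i′ - a i′ zero * T i₀
        ≈⟨ +-congˡ (-‿distribˡ-* _ _) ⟩
      p * T i′ + - a i′ zero * T i₀
        ≈⟨ +-cong (*-distribˡ-sum {n} p _) (*-distribˡ-sum {n} (- a i′ zero) _) ⟩
      ∑[ j < n ] (p * (a i′ (suc j) * y j)) + ∑[ j < n ] (- a i′ zero * (a i₀ (suc j) * y j))
        ≈⟨ ∑-distrib-+ {n} _ _ ⟨
      ∑[ j < n ] (p * (a i′ (suc j) * y j) + - a i′ zero * (a i₀ (suc j) * y j))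
        ≈⟨ (sum-cong n λ j → trans (factor _ _ _ _ _) (*-congʳ (+-congˡ (sym (-‿distribˡ-* _ _))))) ⟩
      ∑[ j < n ] ((p * a i′ (suc j) - a i′ zero * a i₀ (suc j)) * y j)
        ≈⟨ solves i ⟩
      0# ∎
      where
      i′ = punchIn i₀ i
      factor : ∀ u v w s t → u * (v * w) + s * (t * w) ≈ (u * v + s * t) * w
      factor = solve 5 (λ u v w s t → u :* (v :* w) :+ s :* (t :* w) := (u :* v :+ s :* t) :* w) refl
        where open ≈-Solver

    vanishes : ∀ i → p * T i - a i zero * T i₀ ≈ 0#
    vanishes i with i₀ Fin.≟ i
    ... | yes ≡.refl = -‿inverseʳ _
    ... | no  i₀≢i   = ≡.subst (λ i → p * T i - a i zero * T i₀ ≈ 0#)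
                         (Fin.punchIn-punchOut i₀≢i) (punched (punchOut i₀≢i))

  -- A solution is found only up to double negation, since a pivot cannot
  -- be searched for in a Heyting field.
  kernel : ∀ {m n} → m < n → (a : Fin m → Fin n → Carrier) → ¬ ¬ Kernel a
  kernel {zero}  {suc n} _ a none = none ((λ _ → 1#) , (zero , 1#0) , λ ())
  kernel {suc m} {suc n} (s≤s m<n) a none = none
    -- If no entry of the first column is a pivot, tightness makes the column zero, and the first
    -- unit vector is a solution.
    ( (1# ◂ λ _ → 0#)
    , (zero , 1#0)
    , λ i → begin
        a i zero * 1# + ∑[ j < n ] (a i (suc j) * 0#)
          ≈⟨ +-cong (*-identityʳ _) (sum-zero n λ j → zeroʳ (a i (suc j))) ⟩
        a i zero + 0#  ≈⟨ +-identityʳ _ ⟩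
        a i zero       ≈⟨ proj₁ (tight _ _) (noPivot i) ⟩
        0#             ∎ )
    where
    noPivot : ∀ i → ¬ a i zero # 0#
    noPivot i pivot#0 = kernel m<n _ (none ∘ kernel-extend a i pivot#0)

  -- Without `α zero` there are r < q² equations for the q² entries of A, hence a nonzero solution.
  -- The goal is a negation, so a solution up to double negation suffices.
  bilinearAlgorithm⇒q²<r : ∀ {q r} → 2 ≤ q → BilinearAlgorithm q (suc r) → ¬ suc r ≤ q ℕ.* q
  bilinearAlgorithm⇒q²<r {q} {r} 2≤q@(s≤s (s≤s _)) P r<q² =
    kernel r<q² (λ ℓ x → α (suc ℓ) (remQuot q x)) contradictory
    where
    open BilinearAlgorithm P

    contradictory : ¬ Kernel (λ ℓ x → α (suc ℓ) (remQuot q x))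
    contradictory (x , (j₀ , xⱼ#0) , solves) =
      #-irrefl refl (#-congʳ aa≈0 (x#0y#0→xy#0 xⱼ#0 xⱼ#0))
      where
      A : Index q q → Carrier
      A (i , j) = x (combine i j)
      i j : Fin q
      i = proj₁ (remQuot {q} q j₀)
      j = proj₂ (remQuot {q} q j₀)
      a≡ : A (i , j) ≡ x j₀
      a≡ = ≡.cong x (Fin.combine-remQuot {q} q j₀)

      α-vanishes : ∀ ℓ → apply (α (suc ℓ)) A ≈ 0#
      α-vanishes ℓ = begin
        apply (α (suc ℓ)) A
          ≈⟨ (∑∑-cong q q λ i j → reflexive (≡.cong (λ v → α (suc ℓ) v * A (i , j))
               (≡.sym (Fin.remQuot-combine i j)))) ⟩
        _ ≈⟨ sum-combine q q (λ k → α (suc ℓ) (remQuot q k) * x k) ⟨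
        ∑[ k < q ℕ.* q ] (α (suc ℓ) (remQuot q k) * x k) ≈⟨ solves ℓ ⟩
        0# ∎

      κ : Carrier
      κ = apply (α zero) A

      rankOne : ∀ b k → γ zero (k , i) * (κ * apply (β zero) b) ≈ ∑[ j < q ] (A (i , j) * b (j , k))
      rankOne b k = begin
        γ zero (k , i) * (κ * apply (β zero) b)
          ≈⟨ +-identityʳ _ ⟨
        γ zero (k , i) * (κ * apply (β zero) b) + 0#
          ≈⟨ +-congˡ (sum-zero r λ ℓ → *-zeroʳ (γ (suc ℓ) (k , i))
               (trans (*-congʳ (α-vanishes ℓ)) (zeroˡ _))) ⟨
        _ ≈⟨ correct A b i k ⟩
        ∑[ j < q ] (A (i , j) * b (j , k)) ∎

      -- Row i of A B, for B the matrix unit at (j , k′), has the entries g k * h k′. It also equals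
      -- x j₀ times the unit vector k′.
      h : Fin q → Carrier
      h k = κ * apply (β zero) (var F (j , k))
      g : Fin q → Carrier
      g k = γ zero (k , i)

      diagonal : ∀ k → g k * h k ≈ x j₀
      diagonal k = begin
        g k * h k ≈⟨ rankOne (var F (j , k)) k ⟩
        ∑[ j′ < q ] (A (i , j′) * var F (j , k) (j′ , k))
          ≈⟨ sum-single j (λ j′ j′≢j → *-zeroʳ (A (i , j′))
               (var-≢ {v = j , k} {j′ , k} (j′≢j ∘ ≡.sym ∘ ≡.cong proj₁))) ⟩
        A (i , j) * var F (j , k) (j , k) ≈⟨ *-congˡ {A (i , j)} (var-≡ (j , k)) ⟩
        A (i , j) * 1# ≈⟨ *-identityʳ _ ⟩
        A (i , j)      ≡⟨ a≡ ⟩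
        x j₀           ∎

      offDiagonal : ∀ k k′ → k ≢ k′ → g k * h k′ ≈ 0#
      offDiagonal k k′ k≢k′ = trans (rankOne (var F (j , k′)) k)
        (sum-zero q λ j′ → *-zeroʳ (A (i , j′))
          (var-≢ {v = j , k′} {j′ , k} (k≢k′ ∘ ≡.sym ∘ ≡.cong proj₂)))

      k₀ k₁ : Fin q
      k₀ = zero
      k₁ = suc zero

      -- The matrix g k * h k′ is an outer product, so its 2 × 2 minors vanish: the product of two
      -- diagonal entries is that of two off-diagonal ones. Here q ≥ 2 provides k₀ and k₁.
      aa≈0 : x j₀ * x j₀ ≈ 0#
      aa≈0 = begin
        x j₀ * x j₀                 ≈⟨ *-cong (diagonal k₀) (diagonal k₁) ⟨
        g k₀ * h k₀ * (g k₁ * h k₁) ≈⟨ exchange (g k₀) (h k₀) (g k₁) (h k₁) ⟩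
        g k₀ * h k₁ * (g k₁ * h k₀) ≈⟨ *-congʳ (offDiagonal k₀ k₁ λ ()) ⟩
        0# * (g k₁ * h k₀)          ≈⟨ zeroˡ _ ⟩
        0#                          ∎
        where
        exchange : ∀ u v w z → u * v * (w * z) ≈ u * z * (w * v)
        exchange = solve 4 (λ u v w z → u :* v :* (w :* z) := u :* z :* (w :* v)) refl
          where open ≈-Solver

  q²<r : ∀ {q r} → 2 ≤ q → 1 ≤ r → BilinearAlgorithm q r → q ℕ.* q < r
  q²<r {r = suc r} 2≤q 1≤r P = ℕ.≰⇒> (bilinearAlgorithm⇒q²<r 2≤q P)

-- Layered circuits and their compilation to straight-line programs

AllPairs-resp-⊇ : ∀ {a ℓ} {A : Set a} {R : A → A → Set ℓ} {xs ys} →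
                  xs ⊆ ys → AllPairs R ys → AllPairs R xs
AllPairs-resp-⊇ Sublist.[] [] = []
AllPairs-resp-⊇ (_ Sublist.∷ʳ xs⊆ys) (_ ∷ rs) = AllPairs-resp-⊇ xs⊆ys rs
AllPairs-resp-⊇ (≡.refl Sublist.∷ xs⊆ys) (r ∷ rs) =
  All.tabulate (λ x∈xs → All.lookup r (Sublist.lookup xs⊆ys x∈xs)) ∷ AllPairs-resp-⊇ xs⊆ys rs

↑ˡ≢↑ʳ : ∀ {m n} {i : Fin m} {j : Fin n} → i ↑ˡ n ≢ m ↑ʳ j
↑ˡ≢↑ʳ {m} {n} {i} {j} eq
  with () ← ≡.trans (≡.sym (Fin.splitAt-↑ˡ m i n))
              (≡.trans (≡.cong (splitAt m) eq) (Fin.splitAt-↑ʳ m n j))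

module Circuits {c ℓ₁ ℓ₂ : Level} (F : HeytingField c ℓ₁ ℓ₂) where

  open HeytingField F hiding (zero)
  open HeytingProperties heytingCommutativeRing using (#-congʳ)

  private variable
    s t u m : ℕ

  -- Signs are part of the constants, and all gates are total, so that `eval` is a function.
  data Gate (s : ℕ) : Set c where
    constant : Carrier → Gate s
    _⊕_ _⊗_  : (l r : Fin s) → Gate s

  infixl 5 _▷_

  -- Each layer adds m gates, which read only older cells; the new cells
  -- are numbered before the old ones.
  data Circuit (s : ℕ) : ℕ → Set c where
    []  : Circuit s s
    _▷_ : Circuit s t → Vector (Gate t) m → Circuit s (m ℕ.+ t)

  layers : Circuit s t → ℕ
  layers []      = 0
  layers (C ▷ _) = suc (layers C)

  value : Gate s → Memory F s → Carrier
  value (constant k) M = k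
  value (l ⊕ r)      M = M l + M r
  value (l ⊗ r)      M = M l * M r

  eval : Circuit s t → Memory F s → Memory F t
  eval []      M = M
  eval (C ▷ g) M = (λ j → value (g j) (eval C M)) ⧺ eval C M

  embed : Circuit s t → Fin s → Fin t
  embed []                  i = i
  embed (_▷_ {m = m} C _) i = m ↑ʳ embed C i

  eval-embed : (C : Circuit s t) (M : Memory F s) → ∀ i → eval C M (embed C i) ≡ M i
  eval-embed []      M i = ≡.refl
  eval-embed (C ▷ g) M i = ≡.trans
    (Vector.lookup-++ʳ (λ j → value (g j) (eval C M)) (eval C M) (embed C i)) (eval-embed C M i)

  embed-injective : (C : Circuit s t) → ∀ {i j} → embed C i ≡ embed C j → i ≡ j
  embed-injective []                eq = eq
  embed-injective (_▷_ {m = m} C _) eq = embed-injective C (Fin.↑ʳ-injective m _ _ eq)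

  -- Compilation to straight-line programs

  rename : (Fin s → Fin t) → Instr F s → Instr F t
  rename ρ (load i k)        = load (ρ i) k
  rename ρ (compute i o l r) = compute (ρ i) o (ρ l) (ρ r)

  instr : Gate s → (Fin s → Fin t) → Fin t → Instr F t
  instr (constant k) ρ i = load i k
  instr (l ⊕ r)      ρ i = compute i add (ρ l) (ρ r)
  instr (l ⊗ r)      ρ i = compute i mul (ρ l) (ρ r)

  layerInstr : Vector (Gate s) m → Fin m → Instr F (m ℕ.+ s)
  layerInstr {s} {m} g j = instr (g j) (m ↑ʳ_) (j ↑ˡ s)

  -- Every gate owns a cell that is written once and read only by later layers. Hence overwriting
  -- creates no dependencies, and a chain can only follow the flow of data.
  compile : Circuit s t → Program F t
  compile []                       = []
  compile (_▷_ {t = t} {m = m} C g) =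
    List.map (rename (m ↑ʳ_)) (compile C) List.++ List.map (layerInstr g) (List.allFin m)

  -- One instruction per new cell: a bound on the number of cells controls work and space together.
  work-compile : (C : Circuit s t) → work F (compile C) ℕ.+ s ≡ t
  work-compile []      = ≡.refl
  work-compile {s} (_▷_ {t = t} {m = m} C g) = begin
    length (π List.++ λs) ℕ.+ s
      ≡⟨ ≡.cong (ℕ._+ s) (List.length-++ π) ⟩
    length π ℕ.+ length λs ℕ.+ s
      ≡⟨ ≡.cong₂ (λ a b → a ℕ.+ b ℕ.+ s) (List.length-map (rename (m ↑ʳ_)) (compile C))
           (≡.trans (List.length-map (layerInstr g) (List.allFin m)) (List.length-tabulate id)) ⟩
    length (compile C) ℕ.+ m ℕ.+ s
      ≡⟨ ≡.cong (ℕ._+ s) (ℕ.+-comm (length (compile C)) m) ⟩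
    m ℕ.+ length (compile C) ℕ.+ s
      ≡⟨ ℕ.+-assoc m _ s ⟩
    m ℕ.+ (length (compile C) ℕ.+ s)
      ≡⟨ ≡.cong (m ℕ.+_) (work-compile C) ⟩
    m ℕ.+ t ∎
    where
    open ≡.≡-Reasoning
    π λs : Program F (m ℕ.+ t)
    π  = List.map (rename (m ↑ʳ_)) (compile C)
    λs = List.map (layerInstr g) (List.allFin m)

  target-rename : ∀ (ρ : Fin s → Fin t) ι → target F (rename ρ ι) ≡ ρ (target F ι)
  target-rename ρ (load _ _)        = ≡.refl
  target-rename ρ (compute _ _ _ _) = ≡.refl

  sources-rename : ∀ (ρ : Fin s → Fin t) ι → sources F (rename ρ ι) ≡ List.map ρ (sources F ι)
  sources-rename ρ (load _ _)        = ≡.refl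
  sources-rename ρ (compute _ _ _ _) = ≡.refl

  target-instr : ∀ (γ : Gate s) (ρ : Fin s → Fin t) i → target F (instr γ ρ i) ≡ i
  target-instr (constant _) ρ i = ≡.refl
  target-instr (_ ⊕ _)      ρ i = ≡.refl
  target-instr (_ ⊗ _)      ρ i = ≡.refl

  sources-instr : ∀ (γ : Gate s) (ρ : Fin s → Fin t) i {j} → j ∈ sources F (instr γ ρ i) → ∃[ k ] j ≡ ρ k
  sources-instr (l ⊕ r) ρ i (here eq)         = l , eq
  sources-instr (l ⊕ r) ρ i (there (here eq)) = r , eq
  sources-instr (l ⊗ r) ρ i (here eq)         = l , eq
  sources-instr (l ⊗ r) ρ i (there (here eq)) = r , eq

  result-cong : ∀ o {x x′ y y′ v} → x ≈ x′ → y ≈ y′ → Result F o x y v → Result F o x′ y′ v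
  result-cong add x≈ y≈ (lift v≈)     = lift (trans v≈ (+-cong x≈ y≈))
  result-cong sub x≈ y≈ (lift v≈)     = lift (trans v≈ (+-cong x≈ (-‿cong y≈)))
  result-cong mul x≈ y≈ (lift v≈)     = lift (trans v≈ (*-cong x≈ y≈))
  result-cong div x≈ y≈ (y#0 , vy≈x)  = #-congʳ y≈ y#0 , trans (*-congˡ (sym y≈)) (trans vy≈x x≈)

  run-++ : ∀ {π ρ : Program F s} {M M′ M″} → Run F π M M′ → Run F ρ M′ M″ → Run F (π List.++ ρ) M M″
  run-++ done         run′ = run′
  run-++ (step σ run) run′ = step σ (run-++ run run′)

  module _ (m : ℕ) {t : ℕ} where

    rename-step : ∀ (ι : Instr F t) {M : Memory F (m ℕ.+ t)} {N N′} → (∀ i → M (m ↑ʳ i) ≈ N i) →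
                  Step F ι N N′ → Step F (rename (m ↑ʳ_) ι) M ((λ j → M (j ↑ˡ t)) ⧺ N′)
    rename-step ι {M} {N} {N′} M≈N (val , frame) = written ι val , unchanged ι frame
      where
      M′ : Memory F (m ℕ.+ t)
      M′ = (λ j → M (j ↑ˡ t)) ⧺ N′
      M′≡N′ : ∀ i → M′ (m ↑ʳ i) ≡ N′ i
      M′≡N′ = Vector.lookup-++ʳ (λ j → M (j ↑ˡ t)) N′

      written : ∀ ι → Value F ι N (N′ (target F ι)) →
                Value F (rename (m ↑ʳ_) ι) M (M′ (target F (rename (m ↑ʳ_) ι)))
      written (load i k)        (lift v≈k) = lift (trans (reflexive (M′≡N′ i)) v≈k)
      written (compute i o l r) res        rewrite M′≡N′ i =
        result-cong o (sym (M≈N l)) (sym (M≈N r)) res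

      unchanged : ∀ ι → (∀ i → i ≢ target F ι → N′ i ≈ N i) →
                  ∀ i → i ≢ target F (rename (m ↑ʳ_) ι) → M′ i ≈ M i
      unchanged ι frame i i≢ with splitAt m i in eq
      ... | inj₁ j = reflexive (≡.cong M (Fin.splitAt⁻¹-↑ˡ eq))
      ... | inj₂ j with ≡.refl ← Fin.splitAt⁻¹-↑ʳ {m} eq =
        trans (frame j λ { ≡.refl → i≢ (≡.sym (target-rename (m ↑ʳ_) ι)) }) (sym (M≈N j))

    -- The older layers never touch the m cells of the new layer, whose arbitrary contents are
    -- carried along.
    rename-run : ∀ {π : Program F t} {N N′} → Run F π N N′ →
                 ∀ M → (∀ i → M (m ↑ʳ i) ≈ N i) →
                 Σ[ M′ ∈ Memory F (m ℕ.+ t) ] Run F (List.map (rename (m ↑ʳ_)) π) M M′ ×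
                   (∀ i → M′ (m ↑ʳ i) ≈ N′ i)
    rename-run done M M≈N = M , done , M≈N
    rename-run (step {ι = ι} {M′ = N₁} σ run) M M≈N
      with M′ , run′ , M′≈ ← rename-run run ((λ j → M (j ↑ˡ t)) ⧺ N₁)
             (λ i → reflexive (Vector.lookup-++ʳ (λ j → M (j ↑ˡ t)) N₁ i))
      = M′ , step (rename-step ι M≈N σ) run′ , M′≈

  module _ (g : Vector (Gate t) m) (N : Memory F t) where

    private
      V : Memory F (m ℕ.+ t)
      V = (λ j → value (g j) N) ⧺ N

    instr-value : ∀ (γ : Gate t) {M : Memory F (m ℕ.+ t)} i {v} → (∀ i → M (m ↑ʳ i) ≈ N i) →
                  v ≈ value γ N → Value F (instr γ (m ↑ʳ_) i) M v
    instr-value (constant k) i M≈N v≈ = lift v≈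
    instr-value (l ⊕ r)      i M≈N v≈ = lift (trans v≈ (sym (+-cong (M≈N l) (M≈N r))))
    instr-value (l ⊗ r)      i M≈N v≈ = lift (trans v≈ (sym (*-cong (M≈N l) (M≈N r))))

    -- The invariant of a partially executed layer: a new cell already holds its value or is still
    -- listed in `js`. The list is arbitrary to make the induction go through.
    layer-run : ∀ js M → (∀ i → M (m ↑ʳ i) ≈ N i) →
                (∀ j → M (j ↑ˡ t) ≈ value (g j) N ⊎ j ∈ js) →
                Σ[ M′ ∈ Memory F (m ℕ.+ t) ] Run F (List.map (layerInstr g) js) M M′ ×
                  (∀ i → M′ i ≈ V i)
    layer-run [] M M≈N computed = M , done , M≈V
      where
      M≈V : ∀ i → M i ≈ V i
      M≈V i with splitAt m i in eq
      ... | inj₂ j with ≡.refl ← Fin.splitAt⁻¹-↑ʳ {m} eq = M≈N j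
      ... | inj₁ j with ≡.refl ← Fin.splitAt⁻¹-↑ˡ {m} eq with computed j
      ...   | inj₁ M≈ = M≈
    layer-run (j ∷ js) M M≈N computed =
      let M″ , run , M″≈V = layer-run js M′ M′≈N computed′ in M″ , step step′ run , M″≈V
      where
      M′ : Memory F (m ℕ.+ t)
      M′ = updateAt M (j ↑ˡ t) (const (value (g j) N))
      M′-new : M′ (j ↑ˡ t) ≡ value (g j) N
      M′-new = Vector.updateAt-updates (j ↑ˡ t) M
      M′-old : ∀ {i} → i ≢ j ↑ˡ t → M′ i ≡ M i
      M′-old {i} i≢ = Vector.updateAt-minimal i (j ↑ˡ t) M i≢
      step′ : Step F (layerInstr g j) M M′
      step′ rewrite target-instr (g j) (m ↑ʳ_) (j ↑ˡ t) =
        instr-value (g j) (j ↑ˡ t) M≈N (reflexive M′-new) , λ i i≢ → reflexive (M′-old i≢)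
      M′≈N : ∀ i → M′ (m ↑ʳ i) ≈ N i
      M′≈N i = trans (reflexive (M′-old (↑ˡ≢↑ʳ ∘ ≡.sym))) (M≈N i)
      computed′ : ∀ k → M′ (k ↑ˡ t) ≈ value (g k) N ⊎ k ∈ js
      computed′ k with k Fin.≟ j
      ... | yes ≡.refl = inj₁ (reflexive M′-new)
      ... | no  k≢j with computed k
      ...   | inj₁ M≈            = inj₁ (trans (reflexive (M′-old (k≢j ∘ Fin.↑ˡ-injective t k j))) M≈)
      ...   | inj₂ (here k≡j)    = contradiction k≡j k≢j
      ...   | inj₂ (there k∈js)  = inj₂ k∈js

  compile-run : ∀ (C : Circuit s t) (M : Memory F t) →
                Σ[ M′ ∈ Memory F t ] Run F (compile C) M M′ × (∀ i → M′ i ≈ eval C (M ∘ embed C) i)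
  compile-run []                        M = M , done , λ _ → refl
  compile-run (_▷_ {t = t} {m = m} C g) M
    with N , run₁ , N≈ ← compile-run C (M ∘ (m ↑ʳ_))
    with M₁ , run₂ , M₁≈ ← rename-run m run₁ M (λ _ → refl)
    with M₂ , run₃ , M₂≈ ← layer-run g (eval C (M ∘ embed (C ▷ g))) (List.allFin m) M₁
           (λ i → trans (M₁≈ i) (N≈ i)) (λ j → inj₂ (∈-allFin j))
    = M₂ , run-++ run₂ run₃ , M₂≈

  -- Depth

  -- The number of the layer that wrote a cell, 0 for the original cells. On targets it is the
  -- potential that grows along chains.
  level : Circuit s t → Fin t → ℕ
  level []                i = 0
  level (_▷_ {m = m} C g) i = [ const (suc (layers C)) , level C ]′ (splitAt m i)

  level≤layers : (C : Circuit s t) → ∀ i → level C i ≤ layers C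
  level≤layers []                i = z≤n
  level≤layers (_▷_ {m = m} C g) i with splitAt m i
  ... | inj₁ _ = ℕ.≤-refl
  ... | inj₂ j = ℕ.m≤n⇒m≤1+n (level≤layers C j)

  level-new : ∀ (C : Circuit s t) (g : Vector (Gate t) m) j → level (C ▷ g) (j ↑ˡ t) ≡ suc (layers C)
  level-new {t = t} {m = m} C g j rewrite Fin.splitAt-↑ˡ m j t = ≡.refl

  level-old : ∀ (C : Circuit s t) (g : Vector (Gate t) m) i → level (C ▷ g) (m ↑ʳ i) ≡ level C i
  level-old {t = t} {m = m} C g i rewrite Fin.splitAt-↑ʳ m t i = ≡.refl

  depends-rename : ∀ (ρ : Fin s → Fin t) → (∀ {i j} → ρ i ≡ ρ j → i ≡ j) → ∀ ι κ →
                   Depends F (rename ρ ι) (rename ρ κ) → Depends F ι κ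
  depends-rename ρ inj ι κ dep
    rewrite target-rename ρ ι | target-rename ρ κ | sources-rename ρ ι | sources-rename ρ κ
    with dep
  ... | inj₁ (here eq)  = inj₁ (here (inj eq))
  ... | inj₁ (there i∈) with k , k∈ , eq ← ∈-map⁻ ρ i∈ rewrite inj eq = inj₁ (there k∈)
  ... | inj₂ i∈         with k , k∈ , eq ← ∈-map⁻ ρ i∈ rewrite inj eq = inj₂ k∈

  layer-independent : ∀ (g : Vector (Gate t) m) {i j} → i ≢ j →
                      ¬ Depends F (layerInstr g i) (layerInstr g j)
  layer-independent {t} {m} g {i} {j} i≢j dep
    rewrite target-instr (g i) (m ↑ʳ_) (i ↑ˡ t) | target-instr (g j) (m ↑ʳ_) (j ↑ˡ t)
    with dep
  ... | inj₁ (here eq)  = i≢j (Fin.↑ˡ-injective t i j eq)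
  ... | inj₁ (there i∈) = ↑ˡ≢↑ʳ (proj₂ (sources-instr (g j) (m ↑ʳ_) (j ↑ˡ t) i∈))
  ... | inj₂ j∈         = ↑ˡ≢↑ʳ (proj₂ (sources-instr (g i) (m ↑ʳ_) (i ↑ˡ t) j∈))

  targetLevel : Circuit s t → Instr F t → ℕ
  targetLevel C ι = level C (target F ι)

  targetLevel-rename : ∀ (C : Circuit s t) (g : Vector (Gate t) m) ι →
                       targetLevel (C ▷ g) (rename (m ↑ʳ_) ι) ≡ targetLevel C ι
  targetLevel-rename {m = m} C g ι =
    ≡.trans (≡.cong (level (C ▷ g)) (target-rename (m ↑ʳ_) ι)) (level-old C g (target F ι))

  targetLevel-layer : ∀ (C : Circuit s t) (g : Vector (Gate t) m) j →
                      targetLevel (C ▷ g) (layerInstr g j) ≡ suc (layers C)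
  targetLevel-layer {t = t} {m = m} C g j =
    ≡.trans (≡.cong (level (C ▷ g)) (target-instr (g j) (m ↑ʳ_) (j ↑ˡ t))) (level-new C g j)

  -- Being conditional, this holds for all ordered pairs of a program, vacuously within a layer.
  -- Neighbours in a chain may be far apart in the program, so all pairs have to be covered.
  Later : Circuit s t → Instr F t → Instr F t → Set
  Later C ι κ = Depends F ι κ → targetLevel C ι < targetLevel C κ

  compile-later : (C : Circuit s t) → AllPairs (Later C) (compile C)
  compile-later [] = []
  compile-later (_▷_ {t = t} {m = m} C g) = AllPairs.++⁺
    (AllPairs.map⁺ (AllPairs.map old (compile-later C)))
    (AllPairs.map⁺ (AllPairs.tabulate⁺ λ i≢j dep → contradiction dep (layer-independent g i≢j)))
    (All.map⁺ (All.universal (λ ι → All.map⁺ (All.universal (λ j _ → new ι j) _)) _))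
    where
    old : ∀ {ι κ} → Later C ι κ → Later (C ▷ g) (rename (m ↑ʳ_) ι) (rename (m ↑ʳ_) κ)
    old {ι} {κ} later dep rewrite targetLevel-rename C g ι | targetLevel-rename C g κ =
      later (depends-rename (m ↑ʳ_) (Fin.↑ʳ-injective m _ _) ι κ dep)
    new : ∀ ι j → targetLevel (C ▷ g) (rename (m ↑ʳ_) ι) < targetLevel (C ▷ g) (layerInstr g j)
    new ι j rewrite targetLevel-rename C g ι | targetLevel-layer C g j = s≤s (level≤layers C _)

  compile-positive : (C : Circuit s t) → All (λ ι → 1 ≤ targetLevel C ι) (compile C)
  compile-positive [] = []
  compile-positive (_▷_ {t = t} {m = m} C g) = All.++⁺
    (All.map⁺ (All.map (λ {ι} 1≤ → ≡.subst (1 ≤_) (≡.sym (targetLevel-rename C g ι)) 1≤)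
      (compile-positive C)))
    (All.map⁺ (All.universal (λ j → ≡.subst (1 ≤_) (≡.sym (targetLevel-layer C g j)) (s≤s z≤n)) _))

  chain-increasing : ∀ (C : Circuit s t) {ι γ} →
                     Linked (Depends F) (ι ∷ γ) → AllPairs (Later C) (ι ∷ γ) →
                     targetLevel C ι ℕ.+ length γ ≤ layers C
  chain-increasing C {ι} [-] _ =
    ℕ.≤-trans (ℕ.≤-reflexive (ℕ.+-identityʳ _)) (level≤layers C (target F ι))
  chain-increasing C {ι} {κ ∷ γ} (dep ∷ deps) ((later ∷ _) ∷ laters) = begin
    targetLevel C ι ℕ.+ suc (length γ)   ≡⟨ ℕ.+-suc _ _ ⟩
    suc (targetLevel C ι) ℕ.+ length γ   ≤⟨ ℕ.+-monoˡ-≤ (length γ) (later dep) ⟩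
    targetLevel C κ ℕ.+ length γ         ≤⟨ chain-increasing C deps laters ⟩
    layers C                             ∎
    where open ℕ.≤-Reasoning

  depth-compile : ∀ (C : Circuit s t) γ → Chain F (compile C) γ → length γ ≤ layers C
  depth-compile C []      _                 = z≤n
  depth-compile C (ι ∷ γ) (γ⊆π , linked) = ℕ.≤-trans
    -- The level of the first instruction is at least 1, which accounts for that instruction itself.
    (ℕ.+-monoˡ-≤ (length γ) (All.lookup (compile-positive C) (Sublist.lookup γ⊆π (here ≡.refl))))
    (chain-increasing C linked (AllPairs-resp-⊇ γ⊆π (compile-later C)))

-- Padding, indexing and the cost recurrences

pad-zip : ∀ {a b c m} {A : Set a} {B : Set b} {C : Set c} n (h : A → B → C) x y
          (f : Vector A m) (g : Vector B m) w →
          h (pad n x f w) (pad n y g w) ≡ pad n (h x y) (λ i → h (f i) (g i)) w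
pad-zip {m = zero}  n       h x y f g w       = ≡.refl
pad-zip {m = suc m} (suc n) h x y f g zero    = ≡.refl
pad-zip {m = suc m} (suc n) h x y f g (suc w) = pad-zip n h x y (f ∘ suc) (g ∘ suc) w

pad-inject≤ : ∀ {a m n} {A : Set a} (x : A) (f : Vector A m) (m≤n : m ≤ n) i →
              pad n x f (inject≤ i m≤n) ≡ f i
pad-inject≤ {n = suc n} x f (s≤s m≤n) zero    = ≡.refl
pad-inject≤ {n = suc n} x f (s≤s m≤n) (suc i) = pad-inject≤ x (f ∘ suc) m≤n i

infixr 7 _⊗↔_
_⊗↔_ : ∀ {m n} {I J : Set} → I ↔ Fin m → J ↔ Fin n → (I × J) ↔ Fin (m ℕ.* n)
e ⊗↔ f = ↔-sym Fin.*↔× ↔-∘ (e ×-↔ f)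

-- Lq and Lr are upper bounds of log₂ q and log₂ r.  A sum of 2 ^ L products
-- with constants takes at most 3 · 2 ^ L gates in 2 + L layers.
module Cost (q r Lq Lr : ℕ) where

  linearCost outputCost stageCost : ℕ
  linearCost = 3 ℕ.* 2 ℕ.^ (Lq ℕ.+ Lq)
  outputCost = 3 ℕ.* 2 ℕ.^ Lr
  stageCost  = r ℕ.* linearCost ℕ.+ r ℕ.* linearCost ℕ.+ q ℕ.* q ℕ.* outputCost

  -- The cost per product of a batch. A stage evaluates 2 r linear forms and q² outputs at each of
  -- the q ^ (2 k) positions within a block.
  cost : ℕ → ℕ
  cost zero    = 1
  cost (suc k) = r ℕ.* cost k ℕ.+ stageCost ℕ.* (q ℕ.^ k ℕ.* q ℕ.^ k)

  linearDepth outputDepth : ℕ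
  linearDepth = 2 ℕ.+ (Lq ℕ.+ Lq)
  outputDepth = 2 ℕ.+ Lr

  depth : ℕ → ℕ
  depth zero    = 1
  depth (suc k) = linearDepth ℕ.+ (linearDepth ℕ.+ (depth k ℕ.+ outputDepth))

  depth≡ : ∀ k → depth k ≡ 1 ℕ.+ k ℕ.* (6 ℕ.+ 4 ℕ.* Lq ℕ.+ Lr)
  depth≡ zero    = ≡.refl
  depth≡ (suc k) rewrite depth≡ k = stage Lq Lr (k ℕ.* (6 ℕ.+ 4 ℕ.* Lq ℕ.+ Lr))
    where
    stage : ∀ a b c → 2 ℕ.+ (a ℕ.+ a) ℕ.+ (2 ℕ.+ (a ℕ.+ a) ℕ.+ (1 ℕ.+ c ℕ.+ (2 ℕ.+ b))) ≡
                      1 ℕ.+ (6 ℕ.+ 4 ℕ.* a ℕ.+ b ℕ.+ c)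
    stage = solve 3 (λ a b c → con 2 :+ (a :+ a) :+ (con 2 :+ (a :+ a) :+ (con 1 :+ c :+ (con 2 :+ b))) :=
                      con 1 :+ (con 6 :+ con 4 :* a :+ b :+ c)) ≡.refl
      where open +-*-Solver

  -- The leading 1 is the layer that produces the zero for padding. As k ≥ 1, the additive 2 enters
  -- the bracket, where 2 + 6 = 8 ≤ 8 Lq; together with 4 Lq this gives the factor 12.
  depth-bound : ∀ {k} → 1 ≤ k → 1 ≤ Lq → 1 ℕ.+ depth k ≤ 12 ℕ.* ((Lr ℕ.+ Lq) ℕ.* k)
  depth-bound {k} 1≤k 1≤Lq = begin
    1 ℕ.+ depth k                                ≡⟨ ≡.cong suc (depth≡ k) ⟩
    2 ℕ.+ k ℕ.* (6 ℕ.+ 4 ℕ.* Lq ℕ.+ Lr)          ≤⟨ ℕ.+-monoˡ-≤ _ (ℕ.*-monoˡ-≤ 2 1≤k) ⟩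
    k ℕ.* 2 ℕ.+ k ℕ.* (6 ℕ.+ 4 ℕ.* Lq ℕ.+ Lr)    ≡⟨ ℕ.*-distribˡ-+ k 2 _ ⟨
    k ℕ.* (8 ℕ.+ 4 ℕ.* Lq ℕ.+ Lr)                ≤⟨ ℕ.*-monoʳ-≤ k
      (ℕ.+-mono-≤ (ℕ.+-monoˡ-≤ (4 ℕ.* Lq) (ℕ.*-monoʳ-≤ 8 1≤Lq)) (ℕ.m≤n*m Lr 12)) ⟩
    k ℕ.* (8 ℕ.* Lq ℕ.+ 4 ℕ.* Lq ℕ.+ 12 ℕ.* Lr)  ≡⟨ regroup k Lq Lr ⟩
    12 ℕ.* ((Lr ℕ.+ Lq) ℕ.* k)                   ∎
    where
    open ℕ.≤-Reasoning
    regroup : ∀ k a b → k ℕ.* (8 ℕ.* a ℕ.+ 4 ℕ.* a ℕ.+ 12 ℕ.* b) ≡ 12 ℕ.* ((b ℕ.+ a) ℕ.* k)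
    regroup = solve 3 (λ k a b → k :* (con 8 :* a :+ con 4 :* a :+ con 12 :* b) :=
                                con 12 :* ((b :+ a) :* k)) ≡.refl
      where open +-*-Solver

  -- In units of r ^ k: 1 for the zero cell, 1 + `stageCost` for the recursion and 2 for the input
  -- matrices.
  spaceConstant : ℕ
  spaceConstant = 4 ℕ.+ stageCost

  module _ (q²<r : q ℕ.* q < r) where

    -- The additional term on the left absorbs the cost of a stage, as r ≥ q² + 1.
    cost-geometric : ∀ k →
      cost k ℕ.+ stageCost ℕ.* (q ℕ.^ k ℕ.* q ℕ.^ k) ≤ (1 ℕ.+ stageCost) ℕ.* r ℕ.^ k
    cost-geometric zero    = ℕ.≤-reflexive (base stageCost)
      where
      base : ∀ c → 1 ℕ.+ c ℕ.* 1 ≡ (1 ℕ.+ c) ℕ.* 1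
      base = solve 1 (λ c → con 1 :+ c :* con 1 := (con 1 :+ c) :* con 1) ≡.refl
        where open +-*-Solver
    cost-geometric (suc k) = begin
      r ℕ.* cost k ℕ.+ stageCost ℕ.* (N ℕ.* N) ℕ.+ stageCost ℕ.* (q ℕ.* N ℕ.* (q ℕ.* N))
        ≡⟨ factor r (cost k) stageCost N q ⟩
      r ℕ.* cost k ℕ.+ suc (q ℕ.* q) ℕ.* (stageCost ℕ.* (N ℕ.* N))
        ≤⟨ ℕ.+-monoʳ-≤ (r ℕ.* cost k) (ℕ.*-monoˡ-≤ (stageCost ℕ.* (N ℕ.* N)) q²<r) ⟩
      r ℕ.* cost k ℕ.+ r ℕ.* (stageCost ℕ.* (N ℕ.* N))
        ≡⟨ ℕ.*-distribˡ-+ r (cost k) _ ⟨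
      r ℕ.* (cost k ℕ.+ stageCost ℕ.* (N ℕ.* N))
        ≤⟨ ℕ.*-monoʳ-≤ r (cost-geometric k) ⟩
      r ℕ.* ((1 ℕ.+ stageCost) ℕ.* r ℕ.^ k)
        ≡⟨ swap r (1 ℕ.+ stageCost) (r ℕ.^ k) ⟩
      (1 ℕ.+ stageCost) ℕ.* (r ℕ.* r ℕ.^ k) ∎
      where
      open ℕ.≤-Reasoning
      N = q ℕ.^ k
      factor : ∀ r w c n q → r ℕ.* w ℕ.+ c ℕ.* (n ℕ.* n) ℕ.+ c ℕ.* (q ℕ.* n ℕ.* (q ℕ.* n)) ≡
                             r ℕ.* w ℕ.+ (1 ℕ.+ q ℕ.* q) ℕ.* (c ℕ.* (n ℕ.* n))
      factor = solve 5 (λ r w c n q → r :* w :+ c :* (n :* n) :+ c :* (q :* n :* (q :* n)) :=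
                             r :* w :+ (con 1 :+ q :* q) :* (c :* (n :* n))) ≡.refl
        where open +-*-Solver
      swap : ∀ a b c → a ℕ.* (b ℕ.* c) ≡ b ℕ.* (a ℕ.* c)
      swap = solve 3 (λ a b c → a :* (b :* c) := b :* (a :* c)) ≡.refl
        where open +-*-Solver

    square≤ : ∀ k → q ℕ.^ k ℕ.* q ℕ.^ k ≤ r ℕ.^ k
    square≤ zero    = ℕ.≤-refl
    square≤ (suc k) = begin
      q ℕ.* q ℕ.^ k ℕ.* (q ℕ.* q ℕ.^ k)    ≡⟨ ℕ.[m*n]*[o*p]≡[m*o]*[n*p] q (q ℕ.^ k) q (q ℕ.^ k) ⟩
      q ℕ.* q ℕ.* (q ℕ.^ k ℕ.* q ℕ.^ k)    ≤⟨ ℕ.*-mono-≤ (ℕ.<⇒≤ q²<r) (square≤ k) ⟩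
      r ℕ.* r ℕ.^ k                        ∎
      where open ℕ.≤-Reasoning

    space-bound : ∀ {n} k → n ≤ q ℕ.^ k →
                  1 ℕ.+ cost k ℕ.+ (n ℕ.* n ℕ.+ n ℕ.* n) ≤ spaceConstant ℕ.* r ℕ.^ k
    space-bound {n} k n≤qᵏ = begin
      1 ℕ.+ cost k ℕ.+ (n ℕ.* n ℕ.+ n ℕ.* n)
        ≤⟨ ℕ.+-mono-≤ (ℕ.+-mono-≤ (ℕ.m^n>0 r k) (ℕ.≤-trans (ℕ.m≤m+n (cost k) _) (cost-geometric k)))
                      (ℕ.+-mono-≤ n²≤rᵏ n²≤rᵏ) ⟩
      r ℕ.^ k ℕ.+ (1 ℕ.+ stageCost) ℕ.* r ℕ.^ k ℕ.+ (r ℕ.^ k ℕ.+ r ℕ.^ k)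
        ≡⟨ collect (r ℕ.^ k) stageCost ⟩
      spaceConstant ℕ.* r ℕ.^ k ∎
      where
      open ℕ.≤-Reasoning
      instance
        r≢0 : ℕ.NonZero r
        r≢0 = ℕ.>-nonZero (ℕ.≤-<-trans z≤n q²<r)
      n²≤rᵏ : n ℕ.* n ≤ r ℕ.^ k
      n²≤rᵏ = ℕ.≤-trans (ℕ.*-mono-≤ n≤qᵏ n≤qᵏ) (square≤ k)
      collect : ∀ x c → x ℕ.+ (1 ℕ.+ c) ℕ.* x ℕ.+ (x ℕ.+ x) ≡ (4 ℕ.+ c) ℕ.* x
      collect = solve 2 (λ x c → x :+ (con 1 :+ c) :* x :+ (x :+ x) := (con 4 :+ c) :* x) ≡.refl
        where open +-*-Solver

-- Composable circuits and the recursion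

module Blocks {c ℓ₁ ℓ₂ : Level} (F : HeytingField c ℓ₁ ℓ₂) where

  open HeytingField F hiding (zero)
  open Sums F
  open Circuits F
  open SetoidReasoning setoid

  private variable
    s t t′ m : ℕ
    I : Set

  infixl 4 _⨟_

  _⨟_ : Circuit s t → Circuit t t′ → Circuit s t′
  C ⨟ []      = C
  C ⨟ (D ▷ g) = (C ⨟ D) ▷ g

  eval-⨟ : (C : Circuit s t) (D : Circuit t t′) (M : Memory F s) → eval (C ⨟ D) M ≡ eval D (eval C M)
  eval-⨟ C []      M = ≡.refl
  eval-⨟ C (D ▷ g) M = ≡.cong (λ N → (λ j → value (g j) N) ⧺ N) (eval-⨟ C D M)

  layers-⨟ : (C : Circuit s t) (D : Circuit t t′) → layers (C ⨟ D) ≡ layers C ℕ.+ layers D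
  layers-⨟ C []      = ≡.sym (ℕ.+-identityʳ _)
  layers-⨟ C (D ▷ g) = ≡.trans (≡.cong suc (layers-⨟ C D)) (≡.sym (ℕ.+-suc _ _))

  -- The bound w counts only the added cells, so costs add under composition. Outputs are addresses,
  -- which may repeat or point to older cells; selecting or duplicating outputs is therefore free.
  record Block (s : ℕ) (O : Set) (f : Memory F s → O → Carrier) (w d : ℕ) : Set (c ⊔ ℓ₁) where
    field
      {size}  : ℕ
      circuit : Circuit s size
      out     : O → Fin size
      correct : ∀ M o → eval circuit M (out o) ≈ f M o
      size≤   : size ≤ w ℕ.+ s
      layers≤ : layers circuit ≤ d

    final : Memory F s → Memory F size
    final = eval circuit

    keep : Fin s → Fin size
    keep = embed circuit

  open Block

  final-keep : ∀ {O f w d} (X : Block s O f w d) M i → final X M (keep X i) ≈ M i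
  final-keep X M i = reflexive (eval-embed (circuit X) M i)

  infixr 4 _then_

  _then_ : ∀ {O O′ f w d w′ d′} (X : Block s O f w d) {f′ : Memory F (size X) → O′ → Carrier} →
           Block (size X) O′ f′ w′ d′ → Block s O′ (f′ ∘ final X) (w ℕ.+ w′) (d ℕ.+ d′)
  _then_ {s = s} {w = w} {w′ = w′} X Y = record
    { circuit = circuit X ⨟ circuit Y
    ; out     = out Y
    ; correct = λ M o → trans
        (reflexive (≡.cong (_$ out Y o) (eval-⨟ (circuit X) (circuit Y) M)))
        (correct Y (final X M) o)
    ; size≤   = ℕ.≤-trans (size≤ Y) (ℕ.≤-trans (ℕ.+-monoʳ-≤ w′ (size≤ X))
                  (ℕ.≤-reflexive (assoc w′ w s)))
    ; layers≤ = ℕ.≤-trans (ℕ.≤-reflexive (layers-⨟ (circuit X) (circuit Y)))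
                  (ℕ.+-mono-≤ (layers≤ X) (layers≤ Y))
    }
    where
    assoc : ∀ a b c → a ℕ.+ (b ℕ.+ c) ≡ b ℕ.+ a ℕ.+ c
    assoc = solve 3 (λ a b c → a :+ (b :+ c) := b :+ a :+ c) ≡.refl
      where open +-*-Solver

  weaken : ∀ {O O′ f f′ w w′ d d′} (X : Block s O f w d) (ρ : O′ → O) →
           (∀ M o → f M (ρ o) ≈ f′ M o) → w ≤ w′ → d ≤ d′ → Block s O′ f′ w′ d′
  weaken {s = s} X ρ f≈f′ w≤w′ d≤d′ = record
    { circuit = circuit X
    ; out     = out X ∘ ρ
    ; correct = λ M o → trans (correct X M (ρ o)) (f≈f′ M o)
    ; size≤   = ℕ.≤-trans (size≤ X) (ℕ.+-monoˡ-≤ s w≤w′)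
    ; layers≤ = ℕ.≤-trans (layers≤ X) d≤d′
    }

  layer : I ↔ Fin m → (g : I → Gate s) → Block s I (λ M i → value (g i) M) m 1
  layer {m = m} {s = s} e g = record
    { circuit = [] ▷ (g ∘ Inverse.from e)
    ; out     = λ i → Inverse.to e i ↑ˡ s
    ; correct = λ M i → reflexive (≡.trans
        (Vector.lookup-++ˡ (λ j → value (g (Inverse.from e j)) M) M (Inverse.to e i))
        (≡.cong (λ i → value (g i) M) (Inverse.strictlyInverseʳ e i)))
    ; size≤   = ℕ.≤-refl
    ; layers≤ = ℕ.≤-refl
    }

  -- Adding the first half of the summands to the second halves their number, so the gates form a
  -- geometric series. For L = 0 the summand's own cell is the output.
  sumTree : ∀ L → I ↔ Fin m → (v : I → Fin (2 ℕ.^ L) → Fin s) →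
            Block s I (λ M i → ∑[ j < 2 ℕ.^ L ] M (v i j)) (m ℕ.* 2 ℕ.^ L) L
  sumTree {m = m} {s = s} zero e v = record
    { circuit = []
    ; out     = λ i → v i zero
    ; correct = λ M i → sym (+-identityʳ _)
    ; size≤   = ℕ.m≤n+m s (m ℕ.* 1)
    ; layers≤ = z≤n
    }
  sumTree {I = I} {m = m} {s = s} (suc L) e v =
    weaken (pairs then sumTree L e (λ i j → out pairs (i , j))) id total
      (ℕ.≤-reflexive (double m (2 ℕ.^ L))) ℕ.≤-refl
    where
    n = 2 ℕ.^ L
    pairs = layer (e ⊗↔ ↔-id (Fin n)) (λ (i , j) → v i (combine {2} 0F j) ⊕ v i (combine {2} 1F j))

    double : ∀ m n → m ℕ.* n ℕ.+ m ℕ.* n ≡ m ℕ.* (n ℕ.+ (n ℕ.+ 0))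
    double = solve 2 (λ m n → m :* n :+ m :* n := m :* (n :+ (n :+ con 0))) ≡.refl
      where open +-*-Solver

    total : ∀ M i → ∑[ j < n ] final pairs M (out pairs (i , j)) ≈ ∑[ j < 2 ℕ.^ suc L ] M (v i j)
    total M i = begin
      ∑[ j < n ] final pairs M (out pairs (i , j))
        ≈⟨ (sum-cong n λ j → correct pairs M (i , j)) ⟩
      ∑[ j < n ] (M (v i (combine {2} 0F j)) + M (v i (combine {2} 1F j)))
        ≈⟨ ∑-distrib-+ {n} _ _ ⟩
      ∑[ j < n ] M (v i (combine {2} 0F j)) + ∑[ j < n ] M (v i (combine {2} 1F j))
        ≈⟨ +-congˡ (+-identityʳ _) ⟨
      ∑[ b < 2 ] ∑[ j < n ] M (v i (combine b j))
        ≈⟨ sum-combine 2 n (M ∘ v i) ⟨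
      ∑[ j < 2 ℕ.^ suc L ] M (v i j) ∎

  -- Multiplication only reads cells, so coefficients are loaded by a layer of their own; the factor
  -- 3 counts constants, products and the tree.
  dots : ∀ L {w} → w ≤ 2 ℕ.^ L → I ↔ Fin m → (c : I → Fin w → Carrier) (v : I → Fin w → Fin s) →
         Block s I (λ M i → ∑[ x < w ] (c i x * M (v i x))) (m ℕ.* (3 ℕ.* 2 ℕ.^ L)) (2 ℕ.+ L)
  dots {I = I} {m = m} {s = s} L {w} w≤n e c v =
    weaken (constants then products then sumTree L e (λ i j → out products (i , j))) id total
      (ℕ.≤-reflexive (triple m (2 ℕ.^ L))) ℕ.≤-refl
    where
    n = 2 ℕ.^ L

    triple : ∀ m n → m ℕ.* n ℕ.+ (m ℕ.* n ℕ.+ m ℕ.* n) ≡ m ℕ.* (3 ℕ.* n)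
    triple = solve 2 (λ m n → m :* n :+ (m :* n :+ m :* n) := m :* (con 3 :* n)) ≡.refl
      where open +-*-Solver

    constants = layer (e ⊗↔ ↔-id (Fin n)) (λ (i , j) → constant (pad n 0# (c i) j))
    -- Beyond w the coefficient is 0, so that any cell may be its partner.
    products  = layer (e ⊗↔ ↔-id (Fin n)) (λ (i , j) →
      out constants (i , j) ⊗ pad n (out constants (i , j)) (keep constants ∘ v i) j)

    total : ∀ M i → ∑[ j < n ] final products (final constants M) (out products (i , j)) ≈
                    ∑[ x < w ] (c i x * M (v i x))
    total M i = begin
      ∑[ j < n ] final products M₁ (out products (i , j))
        ≈⟨ (sum-cong n λ j → trans (correct products M₁ (i , j)) (product j)) ⟩
      sum (pad n 0# (λ x → c i x * M (v i x)))
        ≈⟨ sum-pad w≤n refl _ ⟩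
      ∑[ x < w ] (c i x * M (v i x)) ∎
      where
      M₁ : Memory F (size constants)
      M₁ = final constants M
      product : ∀ j → M₁ (out constants (i , j)) *
                        M₁ (pad n (out constants (i , j)) (keep constants ∘ v i) j) ≈
                      pad n 0# (λ x → c i x * M (v i x)) j
      product j = trans (*-congʳ (correct constants M (i , j))) (padded w n (c i) (v i) j)
        where
        z = out constants (i , j)
        padded : ∀ w n (c : Fin w → Carrier) (v : Fin w → Fin s) j →
                 pad n 0# c j * M₁ (pad n z (keep constants ∘ v) j) ≈ pad n 0# (λ x → c x * M (v x)) j
        padded zero    n       c v j       = zeroˡ _
        padded (suc w) (suc n) c v zero    = *-congˡ (final-keep constants M (v zero))
        padded (suc w) (suc n) c v (suc j) = padded w n (c ∘ suc) (v ∘ suc) j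

  module Recursion {q r} (P : BilinearAlgorithm q r) (Lq Lr : ℕ)
                   (q≤ : q ≤ 2 ℕ.^ Lq) (r≤ : r ≤ 2 ℕ.^ Lr) where

    open BilinearAlgorithm P renaming (correct to bilinear)

    -- For fixed positions u, w, v inside the blocks, the blocks yield scalar q × q matrices to
    -- which `bilinear` applies. Summing over w completes the inner index x, which is the pair (j ,
    -- w).
    blockwise : ∀ {N} (A B : Matrix F (q ℕ.* N)) a b u v →
      ∑[ ℓ < r ] (γ ℓ (b , a) * ∑[ w < N ]
        (apply (α ℓ) (λ (j , j′) → A (combine j u) (combine j′ w)) *
         apply (β ℓ) (λ (j , j′) → B (combine j w) (combine j′ v)))) ≈
      ∑[ x < q ℕ.* N ] (A (combine a u) x * B x (combine b v))
    blockwise {N} A B a b u v = begin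
      ∑[ ℓ < r ] (γ ℓ (b , a) * ∑[ w < N ] (αA ℓ w * βB ℓ w))
        ≈⟨ (sum-cong r λ ℓ → *-distribˡ-sum {N} _ _) ⟩
      ∑[ ℓ < r ] ∑[ w < N ] (γ ℓ (b , a) * (αA ℓ w * βB ℓ w))
        ≈⟨ ∑-comm {r} {N} _ ⟩
      ∑[ w < N ] ∑[ ℓ < r ] (γ ℓ (b , a) * (αA ℓ w * βB ℓ w))
        ≈⟨ (sum-cong N λ w → bilinear (Aᵇ w) (Bᵇ w) a b) ⟩
      ∑[ w < N ] ∑[ j < q ] (A (combine a u) (combine j w) * B (combine j w) (combine b v))
        ≈⟨ ∑-comm {N} {q} _ ⟩
      ∑[ j < q ] ∑[ w < N ] (A (combine a u) (combine j w) * B (combine j w) (combine b v))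
        ≈⟨ sum-combine q N _ ⟨
      ∑[ x < q ℕ.* N ] (A (combine a u) x * B x (combine b v)) ∎
      where
      Aᵇ Bᵇ : Fin N → Index q q → Carrier
      Aᵇ w (j , j′) = A (combine j u) (combine j′ w)
      Bᵇ w (j , j′) = B (combine j w) (combine j′ v)
      αA βB : Fin r → Fin N → Carrier
      αA ℓ w = apply (α ℓ) (Aᵇ w)
      βB ℓ w = apply (β ℓ) (Bᵇ w)

    open Cost q r Lq Lr

    linearForms : ∀ {J : Set} {N m s} → J ↔ Fin m → (f : J → LinearForm F (Index q q)) →
                  (A : J → Fin (q ℕ.* N) → Fin (q ℕ.* N) → Fin s) →
                  Block s (J × Index N N)
                    (λ M (j , (u , w)) → apply (f j) (λ (i , i′) → M (A j (combine i u) (combine i′ w))))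
                    (m ℕ.* (N ℕ.* N) ℕ.* linearCost) linearDepth
    linearForms {J} {N} {m} {s} e f A =
      weaken (dots (Lq ℕ.+ Lq) q²≤ (e ⊗↔ ↔-id (Fin N) ⊗↔ ↔-id (Fin N)) coefficient cell) id total
        ℕ.≤-refl ℕ.≤-refl
      where
      q²≤ : q ℕ.* q ≤ 2 ℕ.^ (Lq ℕ.+ Lq)
      q²≤ = ℕ.≤-trans (ℕ.*-mono-≤ q≤ q≤) (ℕ.≤-reflexive (≡.sym (ℕ.^-distribˡ-+-* 2 Lq Lq)))
      coefficient : J × Index N N → Fin (q ℕ.* q) → Carrier
      coefficient (j , _) x = f j (remQuot q x)
      entry : J × Index N N → Index q q → Fin s
      entry (j , (u , w)) (i , i′) = A j (combine i u) (combine i′ w)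
      cell : J × Index N N → Fin (q ℕ.* q) → Fin s
      cell o x = entry o (remQuot q x)
      total : ∀ M o → ∑[ x < q ℕ.* q ] (coefficient o x * M (cell o x)) ≈
                      apply (f (proj₁ o)) (M ∘ entry o)
      total M o = sum-remQuot q q (λ x → f (proj₁ o) x * M (entry o x))

    -- The batch index is an arbitrary finite type, since it becomes `I × Fin r` in the recursive
    -- call. Factors are given by the addresses of their entries, so that forming blocks copies
    -- nothing. The depth is the same for every batch size.
    multiply : ∀ k {I : Set} {m s} → I ↔ Fin m → (A B : I → Fin (q ℕ.^ k) → Fin (q ℕ.^ k) → Fin s) →
               Block s (I × Index (q ℕ.^ k) (q ℕ.^ k))
                 (λ M (i , (u , v)) → ∑[ w < q ℕ.^ k ] (M (A i u w) * M (B i w v)))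
                 (m ℕ.* cost k) (depth k)
    multiply zero {m = m} e A B = weaken (layer e (λ i → A i 0F 0F ⊗ B i 0F 0F)) proj₁
      (λ { M (i , (0F , 0F)) → sym (+-identityʳ _) }) (ℕ.≤-reflexive (≡.sym (ℕ.*-identityʳ m))) ℕ.≤-refl
    multiply (suc k) {I} {m} {s} e A B =
      weaken (left then right then recursive then output) place total
        (ℕ.≤-reflexive (distribute m r q (N ℕ.* N) linearCost (cost k) outputCost)) ℕ.≤-refl
      where
      N = q ℕ.^ k

      left      = linearForms (e ⊗↔ ↔-id (Fin r)) (α ∘ proj₂) (A ∘ proj₁)
      -- These forms do not read the results of `left`; placing them after it instead of beside it
      -- adds `linearDepth` to each stage, which is only a constant factor.
      right     = linearForms (e ⊗↔ ↔-id (Fin r)) (β ∘ proj₂) (λ j x y → keep left (B (proj₁ j) x y))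
      recursive = multiply k (e ⊗↔ ↔-id (Fin r))
        (λ j u w → keep right (out left (j , (u , w)))) (λ j w v → out right (j , (w , v)))
      output    = dots Lr r≤ ((e ⊗↔ ↔-id (Fin q) ⊗↔ ↔-id (Fin q)) ⊗↔ ↔-id (Fin N) ⊗↔ ↔-id (Fin N))
        (λ ((i , (a , b)) , _) ℓ → γ ℓ (b , a))
        (λ ((i , _) , uv) ℓ → out recursive ((i , ℓ) , uv))

      place : I × Index (q ℕ.* N) (q ℕ.* N) → (I × Index q q) × Index N N
      place (i , (x , y)) =
        let a , u = remQuot {q} N x ; b , v = remQuot {q} N y in (i , (a , b)) , (u , v)

      distribute : ∀ m r q n l w o → (m ℕ.* r) ℕ.* n ℕ.* l ℕ.+ ((m ℕ.* r) ℕ.* n ℕ.* l ℕ.+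
                     ((m ℕ.* r) ℕ.* w ℕ.+ (m ℕ.* (q ℕ.* q)) ℕ.* n ℕ.* o)) ≡
                   m ℕ.* (r ℕ.* w ℕ.+ (r ℕ.* l ℕ.+ r ℕ.* l ℕ.+ q ℕ.* q ℕ.* o) ℕ.* n)
      distribute = solve 7 (λ m r q n l w o → (m :* r) :* n :* l :+ ((m :* r) :* n :* l :+
                     ((m :* r) :* w :+ (m :* (q :* q)) :* n :* o)) :=
                   m :* (r :* w :+ (r :* l :+ r :* l :+ q :* q :* o) :* n)) ≡.refl
        where open +-*-Solver

      module _ (M : Memory F s) where
        M₁ : Memory F (size left)
        M₁ = final left M
        M₂ : Memory F (size right)
        M₂ = final right M₁
        M₃ : Memory F (size recursive)
        M₃ = final recursive M₂

        combined : ∀ i a b u v →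
          ∑[ ℓ < r ] (γ ℓ (b , a) * M₃ (out recursive ((i , ℓ) , (u , v)))) ≈
          ∑[ x < q ℕ.* N ] (M (A i (combine a u) x) * M (B i x (combine b v)))
        combined i a b u v = trans
          (sum-cong r λ ℓ → *-congˡ (trans (correct recursive M₂ ((i , ℓ) , (u , v)))
            (sum-cong N λ w → *-cong
              (trans (final-keep right M₁ _) (correct left M ((i , ℓ) , (u , w))))
              (trans (correct right M₁ ((i , ℓ) , (w , v)))
                (∑∑-cong q q λ j j′ → *-congˡ (final-keep left M _))))))
          (blockwise (λ x y → M (A i x y)) (λ x y → M (B i x y)) a b u v)

      total : ∀ M o → _
      total M (i , (x , y)) = trans (combined M i a b u v) (reflexive (≡.cong₂
        (λ x′ y′ → ∑[ w < q ℕ.* N ] (M (A i x′ w) * M (B i w y′)))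
        (Fin.combine-remQuot {q} N x) (Fin.combine-remQuot {q} N y)))
        where
        a b : Fin q
        a = proj₁ (remQuot {q} N x)
        b = proj₁ (remQuot {q} N y)
        u v : Fin N
        u = proj₂ (remQuot {q} N x)
        v = proj₂ (remQuot {q} N y)

-- Programs for matrices of arbitrary order

module Programs {c ℓ₁ ℓ₂ : Level} (F : HeytingField c ℓ₁ ℓ₂) where

  open HeytingField F hiding (zero)
  open Sums F
  open Circuits F
  open Blocks F
  open Block
  open SetoidReasoning setoid

  record Multiplication (n S d : ℕ) : Set (c ⊔ ℓ₁ ⊔ ℓ₂) where
    field
      algorithm  : MatrixProgram F n
      multiplies : Multiplies F algorithm
    open MatrixProgram algorithm public
    field
      space≤ : space ≤ S
      work≤  : work F program ≤ S
      depth≤ : ∀ γ → Chain F program γ → length γ ≤ d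

  inputCell : ∀ n → (Index n n ⊎ Index n n) ↔ Fin (n ℕ.* n ℕ.+ n ℕ.* n)
  inputCell n = ↔-sym Fin.+↔⊎ ↔-∘ (↔-sym Fin.*↔× ⊎-↔ ↔-sym Fin.*↔×)

  module _ {n w d} (f : Memory F (n ℕ.* n ℕ.+ n ℕ.* n) → Index n n → Carrier)
           (f≈ : ∀ M i k → f M (i , k) ≈ ∑[ j < n ]
             (M (Inverse.to (inputCell n) (inj₁ (i , j))) * M (Inverse.to (inputCell n) (inj₂ (j , k)))))
           (X : Block (n ℕ.* n ℕ.+ n ℕ.* n) (Index n n) f w d) where

    private
      cell : Index n n ⊎ Index n n → Fin (n ℕ.* n ℕ.+ n ℕ.* n)
      cell = Inverse.to (inputCell n)

    blockProgram : MatrixProgram F n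
    blockProgram = record
      { space   = size X
      ; program = compile (circuit X)
      ; input   = mk↣ {to = keep X ∘ cell}
          (Injection.injective (↔⇒↣ (inputCell n)) ∘ embed-injective (circuit X))
      ; output  = out X
      }

    blockProgram-multiplies : Multiplies F blockProgram
    blockProgram-multiplies A B M A≈ B≈ =
      let M′ , run , M′≈ = compile-run (circuit X) M in
      M′ , run , λ i k → begin
        M′ (out X (i , k))                     ≈⟨ M′≈ (out X (i , k)) ⟩
        final X (M ∘ keep X) (out X (i , k))   ≈⟨ correct X (M ∘ keep X) (i , k) ⟩
        f (M ∘ keep X) (i , k)                 ≈⟨ f≈ (M ∘ keep X) i k ⟩
        ∑[ j < n ] (M (keep X (cell (inj₁ (i , j)))) * M (keep X (cell (inj₂ (j , k)))))
          ≈⟨ (sum-cong n λ j → *-cong (A≈ i j) (B≈ j k)) ⟩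
        matMul F A B i k                       ∎

    multiplication : Multiplication n (w ℕ.+ (n ℕ.* n ℕ.+ n ℕ.* n)) d
    multiplication = record
      { algorithm  = blockProgram
      ; multiplies = blockProgram-multiplies
      ; space≤     = size≤ X
      ; work≤      = ℕ.≤-trans (ℕ.m+n≤o⇒m≤o _ (ℕ.≤-reflexive (work-compile (circuit X)))) (size≤ X)
      ; depth≤     = λ γ chain → ℕ.≤-trans (depth-compile (circuit X) γ chain) (layers≤ X)
      }

  module _ {q r} (P : BilinearAlgorithm q r) (Lq Lr : ℕ) (q≤ : q ≤ 2 ℕ.^ Lq) (r≤ : r ≤ 2 ℕ.^ Lr) where

    open Cost q r Lq Lr
    open Recursion P Lq Lr q≤ r≤

    -- All entries outside the n × n corner are addresses of one shared zero cell, so padding to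
    -- order q ^ k costs a single gate.
    recursiveMultiplication : ∀ {n} k → n ≤ q ℕ.^ k →
      Multiplication n (1 ℕ.+ cost k ℕ.+ (n ℕ.* n ℕ.+ n ℕ.* n)) (1 ℕ.+ depth k)
    recursiveMultiplication {n} k n≤N = multiplication _ total
      (weaken (zeroCell then product) (λ (i , k) → 0F , (inject≤ i n≤N , inject≤ k n≤N)) (λ _ _ → refl)
        (ℕ.≤-reflexive (≡.cong suc (ℕ.*-identityˡ (cost k)))) ℕ.≤-refl)
      where
      N = q ℕ.^ k

      zeroCell = layer (↔-id (Fin 1)) (λ _ → constant 0#)
      z = out zeroCell 0F

      a b : Fin n → Fin n → Fin (size zeroCell)
      a i j = keep zeroCell (Inverse.to (inputCell n) (inj₁ (i , j)))
      b i j = keep zeroCell (Inverse.to (inputCell n) (inj₂ (i , j)))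

      padded : (Fin n → Fin n → Fin (size zeroCell)) → Fin N → Fin N → Fin (size zeroCell)
      padded a = pad N (const z) (pad N z ∘ a)

      product = multiply k (↔-id (Fin 1)) (λ _ → padded a) (λ _ → padded b)

      total : ∀ M i k → _
      total M i k = begin
        ∑[ w < N ] (M₁ (padded a i′ w) * M₁ (padded b w k′))
          ≈⟨ (sum-cong N λ w → reflexive (≡.trans
               (≡.cong (λ row → M₁ (row w) * M₁ (padded b w k′))
                 (pad-inject≤ (const z) (pad N z ∘ a) n≤N i))
               (pad-zip N (λ x row → M₁ x * M₁ (row k′)) z (const z) (a i) (pad N z ∘ b) w))) ⟩
        -- A padded row of `b` points to `z` in every column, hence the default value M₁ z * M₁ z.
        sum (pad N (M₁ z * M₁ z) (λ j → M₁ (a i j) * M₁ (pad N z (b j) k′)))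
          ≈⟨ sum-pad n≤N (trans (*-congʳ (correct zeroCell M 0F)) (zeroˡ _)) _ ⟩
        ∑[ j < n ] (M₁ (a i j) * M₁ (pad N z (b j) k′))
          ≈⟨ (sum-cong n λ j → *-cong (final-keep zeroCell M _)
               (trans (reflexive (≡.cong M₁ (pad-inject≤ z (b j) n≤N k))) (final-keep zeroCell M _))) ⟩
        ∑[ j < n ] (M (Inverse.to (inputCell n) (inj₁ (i , j))) *
                    M (Inverse.to (inputCell n) (inj₂ (j , k)))) ∎
        where
        i′ k′ : Fin N
        i′ = inject≤ i n≤N
        k′ = inject≤ k n≤N
        M₁ : Memory F (size zeroCell)
        M₁ = final zeroCell M

-- Depth bounds and the choice of the algorithm

-- Both factors, the sum log₂ r + log₂ q and log_q n, at most double by rounding, which gives 12 · 4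
-- = 48; the constant 96 is that of the other case.
withinLogs-large : ∀ {q r n d} → 2 ≤ q → 2 ≤ r → q ≤ n →
                   (Lq : CeilLog 2 q) (Lr : CeilLog 2 r) (k : CeilLog q n) →
                   d ≤ 12 ℕ.* ((exponent Lr ℕ.+ exponent Lq) ℕ.* exponent k) → WithinLogs 96 q r n d
withinLogs-large {d = d} 2≤q 2≤r q≤n Lq Lr k d≤ a b u t hr hq hn = begin
  d ℕ.* (t ℕ.* t)
    ≤⟨ ℕ.*-monoˡ-≤ (t ℕ.* t) d≤ ⟩
  12 ℕ.* ((ρ ℕ.+ λq) ℕ.* κ) ℕ.* (t ℕ.* t)
    ≡⟨ distribute ρ λq κ t ⟩
  12 ℕ.* ((ρ ℕ.* t ℕ.+ λq ℕ.* t) ℕ.* (κ ℕ.* t))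
    ≤⟨ ℕ.*-monoʳ-≤ 12 (ℕ.*-mono-≤
         (ℕ.+-mono-≤ (exponent-logAtMost {p = a} ℕ.≤-refl 2≤r Lr hr)
                     (exponent-logAtMost {p = b} ℕ.≤-refl 2≤q Lq hq))
         (exponent-logAtMost {p = u} 2≤q q≤n k hn)) ⟩
  12 ℕ.* ((2 ℕ.* a ℕ.+ 2 ℕ.* b) ℕ.* (2 ℕ.* u))
    ≡⟨ collect a b u ⟩
  48 ℕ.* ((a ℕ.+ b) ℕ.* u)
    ≤⟨ ℕ.*-monoˡ-≤ ((a ℕ.+ b) ℕ.* u) (ℕ.m≤m+n 48 48) ⟩
  96 ℕ.* ((a ℕ.+ b) ℕ.* u) ∎
  where
  open ℕ.≤-Reasoning
  ρ λq κ : ℕ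
  ρ  = exponent Lr
  λq = exponent Lq
  κ  = exponent k
  distribute : ∀ x y z t → 12 ℕ.* ((x ℕ.+ y) ℕ.* z) ℕ.* (t ℕ.* t) ≡
                           12 ℕ.* ((x ℕ.* t ℕ.+ y ℕ.* t) ℕ.* (z ℕ.* t))
  distribute = solve 4 (λ x y z t → con 12 :* ((x :+ y) :* z) :* (t :* t) :=
                           con 12 :* ((x :* t :+ y :* t) :* (z :* t))) ≡.refl
    where open +-*-Solver
  collect : ∀ a b u → 12 ℕ.* ((2 ℕ.* a ℕ.+ 2 ℕ.* b) ℕ.* (2 ℕ.* u)) ≡ 48 ℕ.* ((a ℕ.+ b) ℕ.* u)
  collect = solve 3 (λ a b u → con 12 :* ((con 2 :* a :+ con 2 :* b) :* (con 2 :* u)) :=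
                           con 48 :* ((a :+ b) :* u)) ≡.refl
    where open +-*-Solver

-- Here only log₂ n is rounded, and log₂ n = log₂ q · log_q n is at most the required product. The
-- constant is 12 · 4 · 2, where 4 = log₂ 8 + log₂ 2.
withinLogs-small : ∀ {q r n d} → 2 ≤ n → (k : CeilLog 2 n) → d ≤ 12 ℕ.* (4 ℕ.* exponent k) →
                   WithinLogs 96 q r n d
withinLogs-small {q} {n = n} {d} 2≤n k d≤ a b u t _ hq hn = begin
  d ℕ.* (t ℕ.* t)                    ≤⟨ ℕ.*-monoˡ-≤ (t ℕ.* t) d≤ ⟩
  12 ℕ.* (4 ℕ.* κ) ℕ.* (t ℕ.* t)     ≡⟨ regroup κ (t ℕ.* t) ⟩
  48 ℕ.* (κ ℕ.* (t ℕ.* t))           ≤⟨ ℕ.*-monoʳ-≤ 48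
                                          (exponent-logAtMost {p = b ℕ.* u} ℕ.≤-refl 2≤n k log₂n≤) ⟩
  48 ℕ.* (2 ℕ.* (b ℕ.* u))           ≡⟨ ℕ.*-assoc 48 2 (b ℕ.* u) ⟨
  96 ℕ.* (b ℕ.* u)                   ≤⟨ ℕ.*-monoʳ-≤ 96 (ℕ.*-monoˡ-≤ u (ℕ.m≤n+m b a)) ⟩
  96 ℕ.* ((a ℕ.+ b) ℕ.* u)           ∎
  where
  open ℕ.≤-Reasoning
  κ : ℕ
  κ = exponent k
  log₂n≤ : LogAtMost 2 n (b ℕ.* u) (t ℕ.* t)
  log₂n≤ = logAtMost-trans {2} {q} {n} {b} {u} {t} hq hn
  regroup : ∀ k s → 12 ℕ.* (4 ℕ.* k) ℕ.* s ≡ 48 ℕ.* (k ℕ.* s)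
  regroup = solve 2 (λ k s → con 12 :* (con 4 :* k) :* s := con 48 :* (k :* s)) ≡.refl
    where open +-*-Solver

lemma6p18 : (c ℓ₁ ℓ₂ : Level) →
    ∃[ D ] ((q r : ℕ) → 2 ≤ q → 1 ≤ r →
    ∃[ C ] ((F : HeytingField c ℓ₁ ℓ₂) → RankAtMost F (matMulTensor F q q q) r →
    Σ[ alg ∈ ((n : ℕ) → MatrixProgram F n) ]
    ((n : ℕ) → Multiplies F (alg n)) ×
    ((n : ℕ) → 2 ≤ n →
    WithinPower C n q r (work F (MatrixProgram.program (alg n))) ×
    (∀ γ → Chain F (MatrixProgram.program (alg n)) γ → WithinLogs D q r n (length γ)) ×
    WithinPower C n q r (MatrixProgram.space (alg n)))))
lemma6p18 c ℓ₁ ℓ₂ = 96 , λ q r 2≤q 1≤r → C q r , λ F rank →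
  let good = solution q r 2≤q 1≤r F rank in
  proj₁ ∘ good , proj₁ ∘ proj₂ ∘ good , proj₂ ∘ proj₂ ∘ good
  where
  log₂ : ∀ n → CeilLog 2 n
  log₂ = ceilLog ℕ.≤-refl

  Cˢ : ℕ
  Cˢ = Cost.spaceConstant 2 8 1 3

  Cˡ C : ∀ q r → ℕ
  Cˡ q r = Cost.spaceConstant q r (exponent (log₂ q)) (exponent (log₂ r))
  -- The first term serves n > q, its factor r paying for the rounding of n. The second bounds all
  -- the cases n ≤ q at once, where ⌈log₂ n⌉ ≤ n ≤ q.
  C q r = Cˡ q r ℕ.* r ℕ.+ Cˢ ℕ.* 8 ℕ.^ q

  module _ (q r : ℕ) (2≤q : 2 ≤ q) (1≤r : 1 ≤ r) (F : HeytingField c ℓ₁ ℓ₂)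
           (rank : RankAtMost F (matMulTensor F q q q) r) where

    open Sums F
    open Rank F
    open Programs F

    P : BilinearAlgorithm q r
    P = bilinearAlgorithm rank

    q²<r′ : q ℕ.* q < r
    q²<r′ = q²<r 2≤q 1≤r P

    2≤r : 2 ≤ r
    2≤r = ℕ.≤-trans 2≤q (ℕ.≤-trans (ℕ.m≤m*n q q {{ℕ.>-nonZero (ℕ.<⇒≤ 2≤q)}}) (ℕ.<⇒≤ q²<r′))

    Bounds : ∀ n → MatrixProgram F n → Set c
    Bounds n alg = 2 ≤ n →
      WithinPower (C q r) n q r (work F (MatrixProgram.program alg)) ×
      (∀ γ → Chain F (MatrixProgram.program alg) γ → WithinLogs 96 q r n (length γ)) ×
      WithinPower (C q r) n q r (MatrixProgram.space alg)

    -- The exponents 1 and 3 are log₂ 2 and log₂ 8.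
    small : ∀ n → n ≤ q → Σ[ alg ∈ MatrixProgram F n ] (Multiplies F alg × Bounds n alg)
    small n n≤q = algorithm , multiplies , λ 2≤n →
        power 2≤n work≤
      , (λ γ chain → withinLogs-small {q} {r} 2≤n k (ℕ.≤-trans (depth≤ γ chain)
          (Cost.depth-bound 2 8 1 3 (exponent-positive 2≤n k) ℕ.≤-refl)))
      , power 2≤n space≤
      where
      k : CeilLog 2 n
      k = log₂ n
      open Multiplication (recursiveMultiplication (bilinearAlgorithm (rank-matMulTensor≤ 2)) 1 3
        ℕ.≤-refl ℕ.≤-refl (exponent k) (upper k))
      power : ∀ {w} → 2 ≤ n → w ≤ _ → WithinPower (C q r) n q r w
      power 2≤n w≤ = withinPower-const {q = q} {r} (ℕ.<⇒≤ 2≤n) (begin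
        _                       ≤⟨ w≤ ⟩
        -- The argument 5 ≤ 8 is the inequality 2 · 2 < 8.
        _                       ≤⟨ Cost.space-bound 2 8 1 3 (ℕ.m≤m+n 5 3) (exponent k) (upper k) ⟩
        Cˢ ℕ.* 8 ℕ.^ exponent k ≤⟨ ℕ.*-monoʳ-≤ Cˢ
                                     (ℕ.^-monoʳ-≤ 8 (ℕ.≤-trans (exponent≤ ℕ.≤-refl k) n≤q)) ⟩
        Cˢ ℕ.* 8 ℕ.^ q          ≤⟨ ℕ.m≤n+m (Cˢ ℕ.* 8 ℕ.^ q) (Cˡ q r ℕ.* r) ⟩
        C q r                   ∎)
        where open ℕ.≤-Reasoning

    large : ∀ n → q ≤ n → Σ[ alg ∈ MatrixProgram F n ] (Multiplies F alg × Bounds n alg)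
    large n q≤n = algorithm , multiplies , λ 2≤n →
        power 2≤n work≤
      , (λ γ chain → withinLogs-large 2≤q 2≤r q≤n (log₂ q) (log₂ r) k (ℕ.≤-trans (depth≤ γ chain)
          (Cost.depth-bound q r (exponent (log₂ q)) (exponent (log₂ r))
            (exponent-positive 2≤n k) (exponent-positive 2≤q (log₂ q)))))
      , power 2≤n space≤
      where
      k : CeilLog q n
      k = ceilLog 2≤q n
      open Multiplication (recursiveMultiplication P (exponent (log₂ q)) (exponent (log₂ r))
        (upper (log₂ q)) (upper (log₂ r)) (exponent k) (upper k))
      power : ∀ {w} → 2 ≤ n → w ≤ _ → WithinPower (C q r) n q r w
      power 2≤n w≤ = withinPower-mono {q = q} {r} (ℕ.m≤m+n (Cˡ q r ℕ.* r) (Cˢ ℕ.* 8 ℕ.^ q))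
        (withinPower-exponent {C = Cˡ q r} (ℕ.<⇒≤ 2≤n) k (exponent-positive 2≤n k)
          (ℕ.≤-trans w≤ (Cost.space-bound q r (exponent (log₂ q)) (exponent (log₂ r)) q²<r′
            (exponent k) (upper k))))

    solution : ∀ n → Σ[ alg ∈ MatrixProgram F n ] (Multiplies F alg × Bounds n alg)
    solution n with n ℕ.≤? q
    ... | yes n≤q = small n n≤q
    ... | no  n≰q = large n (ℕ.<⇒≤ (ℕ.≰⇒> n≰q))
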